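{- Let $k\ge1$ be a fixed integer. For $n\ge0$ let $\overline{\mathrm{Kn}}(n,k)$ be the graph whose vertices are the ordered $k$-tuples of distinct elements of $[n]=\{1,\dots,n\}$, two tuples being adjacent when their underlying sets are disjoint. Then $\{\overline{\mathrm{Kn}}(n,k)\}_{n\ge0}$ is a two-level target sequence.
   Context: Graphs are finite and simple; $\hom(F,G)$ denotes the number of graph homomorphisms from $F$ to $G$. A sequence $\{G_q\}_{q\ge0}$ of graphs is strongly polynomial if for every fixed graph $F$ there is a polynomial $p_F$ with $\hom(F,G_q)=p_F(q)$ for all $q\ge0$. A numerical polynomial is $g\in\mathbb Q[x]$ with $g(q)\in\mathbb Z$ for all $q\in\mathbb Z$. Two-level polynomial: let $g$ be an eventually nonnegative numerical polynomial, $S=\{q\in\mathbb N: g(q)\ge0\}$, and $e:S\to\mathbb N\cup\{ -1,\infty\}$. A sequence of polynomials $\{f_q(n)\}_{q\in S}$, with $f_q$ of degree $g(q)$, is a two-level polynomial of degree function $g$ and depth function $e$ if, writing $f_q(n)=\sum_{r=0}^\infty c_r(q)n^{g(q)-r}$ with $c_r(q)=0$ for $r>g(q)$, there exist polynomials $\{\varphi_r(q)\}_{r\ge0}$ such that $c_r(q)=\varphi_r(q)$ for every $q\in S$ and every $r\le e(q)$. For $q\in\mathbb N\setminus S$ one sets $f_q=0$, $e(q)=-1$. Infinite depth means $e(q)=\infty$ for all $q\in S$. A sequence of graphs $\{H_n\}_{n\ge0}$ is a two-level target sequence if for every strongly polynomial sequence $\{G_q\}_{q\ge0}$, $\hom(G_q,H_n)$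 is a two-level polynomial of infinite depth, i.e. there is a two-level polynomial $\{f_q(n)\}$ of infinite depth with $\hom(G_q,H_n)=f_q(n)$ for all $q,n\in\mathbb N$. -}

module Defs where

open import Data.Bool.Base using (if_then_else_)
open import Data.Fin.Base using (Fin; zero; finToFun)
open import Data.Fin.Properties using (_≟_; all?)
open import Data.Integer.Base using (ℤ; +_)
open import Data.List.Base using (List; []; _∷_; length; lookup; map; filter; allFin; foldr)
open import Data.Nat.Base using (ℕ; zero; suc; _^_; _∸_; _≤ᵇ_; NonZero)
  renaming (_≤_ to _≤ℕ_; _<_ to _<ℕ_)
open import Data.Product.Base using (Σ-syntax; ∃-syntax; _×_)
open import Data.Rational.Base using (ℚ; 0ℚ; _/_; _+_; _*_; _≤_)
open import Data.Unit.Base using (⊤)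
open import Data.Empty using (⊥)
open import Function.Definitions using (Injective)
open import Level using (0ℓ)
open import Relation.Binary.Core using (Rel)
open import Relation.Binary.Definitions using (Decidable; Symmetric; Irreflexive)
open import Relation.Binary.PropositionalEquality.Core using (_≡_; _≢_; refl; sym)
open import Relation.Nullary.Decidable.Core using (Dec; map′; _→-dec_; ¬?)
open import Relation.Nullary.Negation.Core using (¬_)

-- Finite simple graphs; the vertices are numbered, so the vertex set is
-- Fin order.  The graph without vertices is allowed.

record Graph : Set₁ where
  field
    order  : ℕ
    _~_    : Rel (Fin order) 0ℓ
    _~?_   : Decidable _~_
    symm   : Symmetric _~_
    irrefl : Irreflexive _≡_ _~_

open Graph using (order)

IsHom : (F G : Graph) → (Fin (order F) → Fin (order G)) → Set
IsHom F G f = ∀ u v → u F.~ v → f u G.~ f v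
  where module F = Graph F
        module G = Graph G

isHom? : (F G : Graph) (f : Fin (order F) → Fin (order G)) → Dec (IsHom F G f)
isHom? F G f = all? λ u → all? λ v → (u F.~? v) →-dec (f u G.~? f v)
  where module F = Graph F
        module G = Graph G

-- finToFun is a bijection (up to pointwise equality), so this list contains
-- every function Fin m → Fin n exactly once.

functions : (m n : ℕ) → List (Fin m → Fin n)
functions m n = map finToFun (allFin (n ^ m))

hom : Graph → Graph → ℕ
hom F G = length (filter (isHom? F G) (functions (order F) (order G)))

injective? : ∀ {m n} (f : Fin m → Fin n) → Dec (Injective _≡_ _≡_ f)
injective? f = map′ (λ h {i} {j} → h i j) (λ h i j → h {i} {j})
  (all? λ i → all? λ j → (f i ≟ f j) →-dec (i ≟ j))

-- A k-tuple of distinct elements of [n] is an injection Fin k → Fin n; the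
-- list contains each of them once.

tuples : (n k : ℕ) → List (Fin k → Fin n)
tuples n k = filter injective? (functions k n)

DisjointTuples : ∀ {n k} → Rel (Fin k → Fin n) 0ℓ
DisjointTuples s t = ∀ a b → s a ≢ t b

disjointTuples? : ∀ {n k} → Decidable (DisjointTuples {n} {k})
disjointTuples? s t = all? λ a → all? λ b → ¬? (s a ≟ t b)

disjointTuples-irrefl : ∀ {n k} .{{_ : NonZero k}} →
                        (s : Fin k → Fin n) → ¬ DisjointTuples s s
disjointTuples-irrefl {k = suc _} s d = d zero zero refl

-- k ≥ 1 is needed: the empty tuple is disjoint from itself, giving a loop.

KnBar : (n k : ℕ) .{{_ : NonZero k}} → Graph
KnBar n k = record
  { order  = length (tuples n k)
  ; _~_    = λ i j → DisjointTuples (tuple i) (tuple j)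
  ; _~?_   = λ i j → disjointTuples? (tuple i) (tuple j)
  ; symm   = λ d a b eq → d b a (sym eq)
  ; irrefl = λ { {i} refl → disjointTuples-irrefl (tuple i) }
  }
  where
  tuple : Fin (length (tuples n k)) → (Fin k → Fin n)
  tuple = lookup (tuples n k)

-- Coefficient lists, constant term first.  Trailing zeros are allowed, so
-- polynomials are only compared through their coefficients or values.

Poly : Set
Poly = List ℚ

coeff : Poly → ℕ → ℚ
coeff []      _       = 0ℚ
coeff (a ∷ _) zero    = a
coeff (_ ∷ p) (suc i) = coeff p i

eval : Poly → ℚ → ℚ
eval p x = foldr (λ a y → a + x * y) 0ℚ p

fromℤ : ℤ → ℚ
fromℤ z = z / 1

fromℕ : ℕ → ℚ
fromℕ n = fromℤ (+ n)

HasDegree : Poly → ℕ → Set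
HasDegree p d = coeff p d ≢ 0ℚ × (∀ i → d <ℕ i → coeff p i ≡ 0ℚ)

-- The coefficient of x^(d − r), read as 0 when r > d.

codegCoeff : Poly → ℕ → ℕ → ℚ
codegCoeff p d r = if r ≤ᵇ d then coeff p (d ∸ r) else 0ℚ

IsNumerical : Poly → Set
IsNumerical g = ∀ (z : ℤ) → ∃[ w ] eval g (fromℤ z) ≡ fromℤ w

NonnegAt : Poly → ℕ → Set
NonnegAt g q = 0ℚ ≤ eval g (fromℕ q)

EventuallyNonneg : Poly → Set
EventuallyNonneg g = ∃[ N ] ∀ q → N ≤ℕ q → NonnegAt g q

StronglyPolynomial : (ℕ → Graph) → Set₁
StronglyPolynomial G =
  ∀ (F : Graph) → Σ[ p ∈ Poly ] ∀ q → fromℕ (hom F (G q)) ≡ eval p (fromℕ q)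

-- Values of depth functions: ℕ ∪ {-1, ∞}.

data Depth : Set where
  minusOne : Depth
  finite   : ℕ → Depth
  ∞        : Depth

_≤ᵈ_ : ℕ → Depth → Set
r ≤ᵈ minusOne = ⊥
r ≤ᵈ finite e = r ≤ℕ e
r ≤ᵈ ∞        = ⊤

-- S = { q ∣ g(q) ≥ 0 } is NonnegAt g.  The sequences e and f are indexed by
-- all of ℕ, with the conventional values e(q) = -1 and f_q = 0 off S.

record IsTwoLevelPolynomial (g : Poly) (e : ℕ → Depth) (f : ℕ → Poly) : Set where
  field
    numerical        : IsNumerical g
    eventuallyNonneg : EventuallyNonneg g
    φ                : ℕ → Poly
    onS  : ∀ q → NonnegAt g q →
           ∃[ d ] fromℕ d ≡ eval g (fromℕ q)
                × HasDegree (f q) d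
                × (∀ r → r ≤ᵈ e q → codegCoeff (f q) d r ≡ eval (φ r) (fromℕ q))
    offS : ∀ q → ¬ NonnegAt g q →
           (∀ i → coeff (f q) i ≡ 0ℚ) × e q ≡ minusOne

InfiniteDepth : Poly → (ℕ → Depth) → Set
InfiniteDepth g e = ∀ q → NonnegAt g q → e q ≡ ∞

IsTwoLevelTarget : (ℕ → Graph) → Set₁
IsTwoLevelTarget H =
  ∀ (G : ℕ → Graph) → StronglyPolynomial G →
  Σ[ g ∈ Poly ] Σ[ e ∈ (ℕ → Depth) ] Σ[ f ∈ (ℕ → Poly) ]
    IsTwoLevelPolynomial g e f
  × InfiniteDepth g e
  × (∀ q n → fromℕ (hom (G q) (H n)) ≡ eval (f q) (fromℕ n))

{-# OPTIONS --safe #-}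

-- A homomorphism from Γ to KnBar n k is a proper n-colouring of the lexicographic product of Γ
-- with the complete graph K_k, so the f_q are chromatic polynomials, of degree k |V(G_q)|.  It
-- remains to see that the codegree r coefficient C r of such a chromatic polynomial is a fixed
-- linear combination of numbers hom(F, G_q).
--
-- Colouring one vertex last gives a recursion for C r whose correction terms have smaller r;
-- hence S ↦ C r (R[S]), as a function of the set S of vertices that keep their edges, is a
-- multilinear polynomial of degree at most 2r.  Its Taylor expansion at the empty set writes
-- C r R as a sum over tuples of at most 2r vertices.  As a polynomial is determined by its
-- values, each summand depends only on which entries of the tuple are equal or adjacent, and
-- sums over tuples of such functions are linear combinations of homomorphism numbers.

module Submission where

open import Defs
open import Data.Bool.Base using (Bool; true; false; if_then_else_; _∧_; _∨_; not)
  renaming (T to IsTrue)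
open import Data.Bool.Properties as Bool using (⇔→≡; ∧-identityʳ; ∧-zeroʳ; ∨-zeroʳ)
open import Data.Empty using (⊥-elim)
open import Data.Fin.Base
  using (Fin; zero; suc; _<_; toℕ; _↑ˡ_; _↑ʳ_; combine; remQuot; finToFun; punchOut)
open import Data.Fin.Properties as Fin
  using (_<?_; all?; combine-remQuot; remQuot-combine; punchIn-punchOut)
open import Data.Integer.Base as ℤ using (ℤ; -[1+_])
import Data.Integer.Properties as ℤ
open import Data.List.Base as List using (List; []; _∷_; length; filter)
import Data.List.Membership.DecPropositional as DecMembership
open import Data.List.Relation.Unary.All as All using (All; []; _∷_)
open import Data.List.Relation.Unary.Any as Any using (Any; here; there; any?)
open import Data.Nat.Base as ℕ using (ℕ; zero; suc; z≤n; s≤s; _!; NonZero)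
import Data.Nat.Properties as ℕ
open import Data.Product.Base using (Σ-syntax; ∃-syntax; _×_; _,_; proj₁; proj₂)
open import Data.Product.Properties using (≡-dec)
open import Data.Rational.Base
  using (ℚ; 0ℚ; 1ℚ; _+_; _*_; _-_; -_; 1/_; _≤_; mkℚ; toℚᵘ; ↥_; ↧ₙ_; ≢-nonZero)
import Data.Rational.Properties as ℚ
open import Data.Rational.Solver using (module +-*-Solver)
import Data.Rational.Unnormalised.Base as ℚᵘ
import Data.Rational.Unnormalised.Properties as ℚᵘ
open import Data.Sum.Base using (_⊎_; inj₁; inj₂; swap)
open import Data.Unit.Base using (⊤; tt)
open import Data.Vec.Base as Vec
  using (Vec; []; _∷_; _++_; concat; lookup; _[_]≔_; replicate; insertAt; allFin; zipWith)
open import Data.Vec.Properties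
  using ( []≔-idempotent; []≔-commutes; lookup∘update; lookup∘update′; lookup-map; lookup-replicate
        ; insertAt-lookup; insertAt-punchIn; map-insertAt; map-lookup-allFin; map-∘; map-cong
        ; lookup-zipWith; lookup-concat)
open import Function.Base using (_∘_)
open import Function.Bundles using (mk⇔)
open import Function.Definitions using (Injective)
open import Relation.Binary.PropositionalEquality
open import Relation.Nullary
open import Relation.Nullary.Decidable
  using (dec-true; dec-false; decidable-stable; _→-dec_; _⊎-dec_; ¬?)

open +-*-Solver using (solve; con; _:=_; _:+_; _:*_; _:-_; :-_)

-- The recursion for `C` visits the vertices in their numbering and adds edges on the way, so it
-- does not show that `C r` depends on only a few vertices at a time. Two views of the same numbers
-- are therefore combined. The recursion bounds the degree of S ↦ `C r N (restrict R S)` by a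
-- constant that does not grow with the number of vertices. The interpretation as a count of
-- colourings shows that a subset of the entries of a tuple contributes only through the graph
-- induced on it. `restrict` removes edges and keeps all vertices because an isolated vertex
-- multiplies the chromatic polynomial by x, which leaves the coefficients counted from the top
-- unchanged. Hence no index moves with S, and graphs with different numbers of vertices can be
-- compared at the same r. The Taylor coefficients are summed over ordered tuples, at the price of a
-- factor s!, because homomorphism numbers are sums over tuples as well.

fromℤ-+ : ∀ a b → fromℤ (a ℤ.+ b) ≡ fromℤ a + fromℤ b
fromℤ-+ a b = ℚ.toℚᵘ-injective (begin
  toℚᵘ (fromℤ (a ℤ.+ b))              ≈⟨ ℚ.toℚᵘ-fromℚᵘ (ℚᵘ.mkℚᵘ (a ℤ.+ b) 0) ⟩
  ℚᵘ.mkℚᵘ (a ℤ.+ b) 0                 ≈⟨ ℚᵘ.*≡* (cong (ℤ._* ℤ.+ 1) (cong₂ ℤ._+_ (ℤ.*-identityʳ a) (ℤ.*-identityʳ b))) ⟨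
  ℚᵘ.mkℚᵘ a 0 ℚᵘ.+ ℚᵘ.mkℚᵘ b 0        ≈⟨ ℚᵘ.+-cong (ℚ.toℚᵘ-fromℚᵘ (ℚᵘ.mkℚᵘ a 0)) (ℚ.toℚᵘ-fromℚᵘ (ℚᵘ.mkℚᵘ b 0)) ⟨
  toℚᵘ (fromℤ a) ℚᵘ.+ toℚᵘ (fromℤ b)  ≈⟨ ℚ.toℚᵘ-homo-+ (fromℤ a) (fromℤ b) ⟨
  toℚᵘ (fromℤ a + fromℤ b)            ∎)
  where open ℚᵘ.≃-Reasoning

fromℤ-* : ∀ a b → fromℤ (a ℤ.* b) ≡ fromℤ a * fromℤ b
fromℤ-* a b = ℚ.toℚᵘ-injective (begin
  toℚᵘ (fromℤ (a ℤ.* b))              ≈⟨ ℚ.toℚᵘ-fromℚᵘ (ℚᵘ.mkℚᵘ (a ℤ.* b) 0) ⟩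
  ℚᵘ.mkℚᵘ a 0 ℚᵘ.* ℚᵘ.mkℚᵘ b 0        ≈⟨ ℚᵘ.*-cong (ℚ.toℚᵘ-fromℚᵘ (ℚᵘ.mkℚᵘ a 0)) (ℚ.toℚᵘ-fromℚᵘ (ℚᵘ.mkℚᵘ b 0)) ⟨
  toℚᵘ (fromℤ a) ℚᵘ.* toℚᵘ (fromℤ b)  ≈⟨ ℚ.toℚᵘ-homo-* (fromℤ a) (fromℤ b) ⟨
  toℚᵘ (fromℤ a * fromℤ b)            ∎)
  where open ℚᵘ.≃-Reasoning

fromℤ-injective : ∀ {a b} → fromℤ a ≡ fromℤ b → a ≡ b
fromℤ-injective {a} {b} eq with ℚ.fromℚᵘ-injective {ℚᵘ.mkℚᵘ a 0} {ℚᵘ.mkℚᵘ b 0} eq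
... | ℚᵘ.*≡* e = trans (sym (ℤ.*-identityʳ a)) (trans e (ℤ.*-identityʳ b))

fromℕ-injective : ∀ {a b} → fromℕ a ≡ fromℕ b → a ≡ b
fromℕ-injective e = ℤ.+-injective (fromℤ-injective e)

fromℕ-suc : ∀ n → fromℕ (suc n) ≡ 1ℚ + fromℕ n
fromℕ-suc n = fromℤ-+ (ℤ.+ 1) (ℤ.+ n)

fromℕ-+ : ∀ m n → fromℕ (m ℕ.+ n) ≡ fromℕ m + fromℕ n
fromℕ-+ m n = fromℤ-+ (ℤ.+ m) (ℤ.+ n)

fromℕ-* : ∀ m n → fromℕ (m ℕ.* n) ≡ fromℕ m * fromℕ n
fromℕ-* m n = trans (cong fromℤ (ℤ.pos-* m n)) (fromℤ-* (ℤ.+ m) (ℤ.+ n))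

-- Indicators and finite sums

infixr 5 _▷_

_▷_ : Bool → ℚ → ℚ
b ▷ x = if b then x else 0ℚ

▷-+ : ∀ b x y → b ▷ (x + y) ≡ (b ▷ x) + (b ▷ y)
▷-+ true  x y = refl
▷-+ false x y = sym (ℚ.+-identityˡ 0ℚ)

▷-0 : ∀ b → b ▷ 0ℚ ≡ 0ℚ
▷-0 true  = refl
▷-0 false = refl

▷-∧ : ∀ b c x → (b ∧ c) ▷ x ≡ b ▷ c ▷ x
▷-∧ true  c x = refl
▷-∧ false c x = refl

▷-comm : ∀ b c x → b ▷ c ▷ x ≡ c ▷ b ▷ x
▷-comm true  c x = refl
▷-comm false c x = sym (▷-0 c)

▷-scale : ∀ b y x → b ▷ (y * x) ≡ y * (b ▷ x)
▷-scale true  y x = refl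
▷-scale false y x = sym (ℚ.*-zeroʳ y)

-- Index types closed under vectors: the same sum lemmas then serve vertices, tuples of vertices,
-- colourings, and vectors of k-tuples.
data Code : Set where
  fin : ℕ → Code
  vec : Code → ℕ → Code

El : Code → Set
El (fin n)   = Fin n
El (vec c s) = Vec (El c) s

∑ : ∀ c → (El c → ℚ) → ℚ
∑ (fin zero)      F = 0ℚ
∑ (fin (suc n))   F = F zero + ∑ (fin n) (λ i → F (suc i))
∑ (vec c zero)    F = F []
∑ (vec c (suc s)) F = ∑ c (λ x → ∑ (vec c s) (λ v → F (x ∷ v)))

∑-cong : ∀ c {F G : El c → ℚ} → (∀ x → F x ≡ G x) → ∑ c F ≡ ∑ c G
∑-cong (fin zero)      e = refl
∑-cong (fin (suc n))   e = cong₂ _+_ (e zero) (∑-cong (fin n) (λ i → e (suc i)))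
∑-cong (vec c zero)    e = e []
∑-cong (vec c (suc s)) e = ∑-cong c (λ x → ∑-cong (vec c s) (λ v → e (x ∷ v)))

∑-0 : ∀ c → ∑ c (λ _ → 0ℚ) ≡ 0ℚ
∑-0 (fin zero)      = refl
∑-0 (fin (suc n))   = trans (ℚ.+-identityˡ _) (∑-0 (fin n))
∑-0 (vec c zero)    = refl
∑-0 (vec c (suc s)) = trans (∑-cong c (λ x → ∑-0 (vec c s))) (∑-0 c)

∑-+ : ∀ c (F G : El c → ℚ) → ∑ c (λ x → F x + G x) ≡ ∑ c F + ∑ c G
∑-+ (fin zero)      F G = sym (ℚ.+-identityˡ 0ℚ)
∑-+ (fin (suc n))   F G = trans (cong ((F zero + G zero) +_) (∑-+ (fin n) (F ∘ suc) (G ∘ suc)))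
                                (interchange (F zero) (G zero) _ _)
  where
  interchange : ∀ a b c d → (a + b) + (c + d) ≡ (a + c) + (b + d)
  interchange = solve 4 (λ a b c d → (a :+ b) :+ (c :+ d) := (a :+ c) :+ (b :+ d)) refl
∑-+ (vec c zero)    F G = refl
∑-+ (vec c (suc s)) F G =
  trans (∑-cong c (λ x → ∑-+ (vec c s) (λ v → F (x ∷ v)) (λ v → G (x ∷ v)))) (∑-+ c _ _)

∑-* : ∀ c a (F : El c → ℚ) → ∑ c (λ x → a * F x) ≡ a * ∑ c F
∑-* (fin zero)      a F = sym (ℚ.*-zeroʳ a)
∑-* (fin (suc n))   a F = trans (cong (a * F zero +_) (∑-* (fin n) a (F ∘ suc)))
                                (sym (ℚ.*-distribˡ-+ a _ _))
∑-* (vec c zero)    a F = refl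
∑-* (vec c (suc s)) a F =
  trans (∑-cong c (λ x → ∑-* (vec c s) a (λ v → F (x ∷ v)))) (∑-* c a _)

∑-comm : ∀ c d (F : El c → El d → ℚ) →
         ∑ c (λ x → ∑ d (λ y → F x y)) ≡ ∑ d (λ y → ∑ c (λ x → F x y))
∑-comm (fin zero)      d F = sym (∑-0 d)
∑-comm (fin (suc n))   d F = trans (cong (∑ d (F zero) +_) (∑-comm (fin n) d (F ∘ suc)))
                                   (sym (∑-+ d _ _))
∑-comm (vec c zero)    d F = refl
∑-comm (vec c (suc s)) d F =
  trans (∑-cong c (λ x → ∑-comm (vec c s) d (λ v → F (x ∷ v)))) (∑-comm c d _)

∑-▷ : ∀ c b (F : El c → ℚ) → ∑ c (λ x → b ▷ F x) ≡ b ▷ ∑ c F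
∑-▷ c true  F = refl
∑-▷ c false F = ∑-0 c

∑-neg : ∀ c (F : El c → ℚ) → ∑ c (λ x → - F x) ≡ - ∑ c F
∑-neg c F = trans (∑-cong c (λ x → lem (F x))) (trans (∑-* c (- 1ℚ) F) (sym (lem (∑ c F))))
  where
  lem : ∀ x → - x ≡ (- 1ℚ) * x
  lem = solve 1 (λ x → :- x := con (- 1ℚ) :* x) refl

∑-- : ∀ c (F G : El c → ℚ) → ∑ c (λ x → F x - G x) ≡ ∑ c F - ∑ c G
∑-- c F G = trans (∑-+ c F _) (cong (∑ c F +_) (∑-neg c G))

∑-const : ∀ n x → ∑ (fin n) (λ _ → x) ≡ fromℕ n * x
∑-const zero    x = sym (ℚ.*-zeroˡ x)
∑-const (suc n) x = begin
  x + ∑ (fin n) (λ _ → x)  ≡⟨ cong (x +_) (∑-const n x) ⟩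
  x + fromℕ n * x          ≡⟨ lem x (fromℕ n) ⟩
  (1ℚ + fromℕ n) * x       ≡⟨ cong (_* x) (fromℕ-suc n) ⟨
  fromℕ (suc n) * x        ∎
  where
  open ≡-Reasoning
  lem : ∀ x y → x + y * x ≡ (1ℚ + y) * x
  lem = solve 2 (λ x y → x :+ y :* x := (con 1ℚ :+ y) :* x) refl

∑-δ : ∀ {n} (y : Fin n) (F : Fin n → ℚ) → ∑ (fin n) (λ x → does (x Fin.≟ y) ▷ F x) ≡ F y
∑-δ {suc n} zero F = trans (cong (F zero +_) (∑-0 (fin n))) (ℚ.+-identityʳ _)
∑-δ (suc y) F = trans (ℚ.+-identityˡ _) (∑-δ y (F ∘ suc))

-- Chromatic polynomials

does⇒ : {P : Set} (p? : Dec P) → does p? ≡ true → P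
does⇒ (yes p) _ = p

⇔⇒≡ : {a b : Bool} → (a ≡ true → b ≡ true) → (b ≡ true → a ≡ true) → a ≡ b
⇔⇒≡ f g = ⇔→≡ (mk⇔ f g)

∧-true : ∀ {a b} → a ∧ b ≡ true → a ≡ true × b ≡ true
∧-true {true} {true} _ = refl , refl

∨-true : ∀ {a b} → a ∨ b ≡ true → a ≡ true ⊎ b ≡ true
∨-true {true}  _ = inj₁ refl
∨-true {false} e = inj₂ e

∨-introˡ : ∀ {a b} → a ≡ true → a ∨ b ≡ true
∨-introˡ refl = refl

∨-introʳ : ∀ {a b} → b ≡ true → a ∨ b ≡ true
∨-introʳ {a} refl = ∨-zeroʳ a

Adj : ℕ → Set
Adj N = Fin N → Fin N → Bool

deleteZero : ∀ {N} → Adj (suc N) → Adj N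
deleteZero R i j = R (suc i) (suc j)

-- `merge` inserts an edge in one direction only, so adjacency has to be read in both directions.
nb : ∀ {N} → Adj (suc N) → Fin N → Bool
nb R i = R zero (suc i) ∨ R (suc i) zero

-- This is deletion-contraction applied to the edges at the vertex zero one after the other:
-- contracting the edge to `u` once the edges to the earlier neighbours are deleted joins `u` to the
-- later neighbours only.
merge : ∀ {N} → Adj (suc N) → Fin N → Adj N
merge R u i j = R (suc i) (suc j) ∨ (does (i Fin.≟ u) ∧ does (u <? j) ∧ nb R j)

-- The coefficient of x^(N - r) in the chromatic polynomial of R.  When the vertex zero is coloured
-- last, it loses one colour for every neighbour u that is the last one of its colour, and
-- merge R u forces u to be that.
C : ℕ → ∀ N → Adj N → ℚ
C zero    N       R = 1ℚ
C (suc r) zero    R = 0ℚ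
C (suc r) (suc N) R = C (suc r) N (deleteZero R) - ∑ (fin N) (λ u → nb R u ▷ C r N (merge R u))

-- Diagonal entries are ignored, as `C` ignores them; so `chromatic` holds for every `R`.
Proper : ∀ {n N} → Adj N → Vec (Fin n) N → Set
Proper R c = ∀ i j → i ≢ j → R i j ≡ true → lookup c i ≢ lookup c j

proper? : ∀ {n N} (R : Adj N) (c : Vec (Fin n) N) → Dec (Proper R c)
proper? R c = all? λ i → all? λ j → ¬? (i Fin.≟ j) →-dec ((R i j Bool.≟ true) →-dec ¬? (lookup c i Fin.≟ lookup c j))

colourings : ∀ n N → Adj N → ℚ
colourings n N R = ∑ (vec (fin n) N) (λ c → does (proper? R c) ▷ 1ℚ)

-- Coefficients are indexed from the leading one, as in the definition of a two-level polynomial;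
-- multiplication by x then leaves the sequence `a` alone.
fromTop : (ℕ → ℚ) → ℕ → Poly
fromTop a zero    = a 0 ∷ []
fromTop a (suc N) = a (suc N) ∷ fromTop a N

C-ext : ∀ r N {R R′ : Adj N} → (∀ i j → R i j ≡ R′ i j) → C r N R ≡ C r N R′
C-ext zero    N       e = refl
C-ext (suc r) zero    e = refl
C-ext (suc r) (suc N) {R} {R′} e = cong₂ _-_
  (C-ext (suc r) N (λ i j → e (suc i) (suc j)))
  (∑-cong (fin N) λ u → cong₂ _▷_ (nb-ext u)
    (C-ext r N (λ i j → cong₂ _∨_ (e (suc i) (suc j))
      (cong (λ b → does (i Fin.≟ u) ∧ does (u <? j) ∧ b) (nb-ext j)))))
  where
  nb-ext : ∀ i → nb R i ≡ nb R′ i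
  nb-ext i = cong₂ _∨_ (e zero (suc i)) (e (suc i) zero)

C-vanish : ∀ r N (R : Adj N) → N ℕ.< r → C r N R ≡ 0ℚ
C-vanish (suc r) zero    R _         = refl
C-vanish (suc r) (suc N) R (s≤s N<r) = begin
  C (suc r) N (deleteZero R) - ∑ (fin N) (λ u → nb R u ▷ C r N (merge R u))
    ≡⟨ cong₂ _-_ (C-vanish (suc r) N (deleteZero R) (ℕ.m<n⇒m<1+n N<r))
                 (trans (∑-cong (fin N) λ u → trans (cong (nb R u ▷_) (C-vanish r N (merge R u) N<r)) (▷-0 (nb R u)))
                        (∑-0 (fin N))) ⟩
  0ℚ - 0ℚ ∎
  where open ≡-Reasoning

-- The merged graphs have one vertex fewer, so their coefficients enter one codegree later.
eval-fromTop-shift : ∀ (a b c : ℕ → ℚ) x → c 0 ≡ a 0 → (∀ r → c (suc r) ≡ a (suc r) - b r) →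
  ∀ N → eval (fromTop c (suc N)) x ≡ eval (fromTop a (suc N)) x - eval (fromTop b N) x
eval-fromTop-shift a b c x e₀ e zero
  rewrite e₀ | e 0 = lem (a 1) (a 0) (b 0) x
  where
  lem : ∀ p q r x → (p - r) + x * (q + x * 0ℚ) ≡ (p + x * (q + x * 0ℚ)) - (r + x * 0ℚ)
  lem = solve 4 (λ p q r x → (p :- r) :+ x :* (q :+ x :* con 0ℚ) := (p :+ x :* (q :+ x :* con 0ℚ)) :- (r :+ x :* con 0ℚ)) refl
eval-fromTop-shift a b c x e₀ e (suc N)
  rewrite eval-fromTop-shift a b c x e₀ e N | e (suc N) = lem (a (suc (suc N))) (b (suc N)) x _ _
  where
  lem : ∀ p r x s t → (p - r) + x * (s - t) ≡ (p + x * s) - (r + x * t)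
  lem = solve 5 (λ p r x s t → (p :- r) :+ x :* (s :- t) := (p :+ x :* s) :- (r :+ x :* t)) refl

eval-fromTop-∑ : ∀ d (b : El d → Bool) (a : El d → ℕ → ℚ) x N →
  eval (fromTop (λ r → ∑ d (λ u → b u ▷ a u r)) N) x ≡ ∑ d (λ u → b u ▷ eval (fromTop (a u) N) x)
eval-fromTop-∑ d b a x zero    = begin
  ∑ d (λ u → b u ▷ a u 0) + x * 0ℚ        ≡⟨ drop (∑ d (λ u → b u ▷ a u 0)) x ⟩
  ∑ d (λ u → b u ▷ a u 0)                 ≡⟨ ∑-cong d (λ u → cong (b u ▷_) (drop (a u 0) x)) ⟨
  ∑ d (λ u → b u ▷ (a u 0 + x * 0ℚ))      ∎
  where
  open ≡-Reasoning
  drop : ∀ y x → y + x * 0ℚ ≡ y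
  drop = solve 2 (λ y x → y :+ x :* con 0ℚ := y) refl
eval-fromTop-∑ d b a x (suc N) = begin
  ∑ d (λ u → b u ▷ a u (suc N)) + x * eval (fromTop (λ r → ∑ d (λ u → b u ▷ a u r)) N) x
    ≡⟨ cong (λ y → ∑ d (λ u → b u ▷ a u (suc N)) + x * y) (eval-fromTop-∑ d b a x N) ⟩
  ∑ d (λ u → b u ▷ a u (suc N)) + x * ∑ d (λ u → b u ▷ eval (fromTop (a u) N) x)
    ≡⟨ cong (∑ d (λ u → b u ▷ a u (suc N)) +_) (∑-* d x _) ⟨
  ∑ d (λ u → b u ▷ a u (suc N)) + ∑ d (λ u → x * (b u ▷ eval (fromTop (a u) N) x))
    ≡⟨ ∑-+ d _ _ ⟨
  ∑ d (λ u → (b u ▷ a u (suc N)) + x * (b u ▷ eval (fromTop (a u) N) x))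
    ≡⟨ ∑-cong d (λ u → trans (cong ((b u ▷ a u (suc N)) +_) (sym (▷-scale (b u) x _))) (sym (▷-+ (b u) _ _))) ⟩
  ∑ d (λ u → b u ▷ (a u (suc N) + x * eval (fromTop (a u) N) x)) ∎
  where open ≡-Reasoning

fresh : ∀ {n N} → Fin n → (Fin N → Bool) → Vec (Fin n) N → Bool
fresh x b []      = true
fresh x b (y ∷ c) = not (b zero ∧ does (x Fin.≟ y)) ∧ fresh x (b ∘ suc) c

freshAfter : ∀ {n N} → Fin N → (Fin N → Bool) → Vec (Fin n) N → Bool
freshAfter zero    b (y ∷ c) = fresh y (b ∘ suc) c
freshAfter (suc u) b (y ∷ c) = freshAfter u (b ∘ suc) c

fresh⇒ : ∀ {n N} (x : Fin n) (b : Fin N → Bool) c → fresh x b c ≡ true →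
         ∀ j → b j ≡ true → x ≢ lookup c j
fresh⇒ x b (y ∷ c) f zero bj x≡y with b zero | x Fin.≟ y
... | true  | no x≢y = x≢y x≡y
fresh⇒ x b (y ∷ c) f (suc j) bj = fresh⇒ x (b ∘ suc) c (proj₂ (∧-true f)) j bj

⇒fresh : ∀ {n N} (x : Fin n) (b : Fin N → Bool) c →
         (∀ j → b j ≡ true → x ≢ lookup c j) → fresh x b c ≡ true
⇒fresh x b []      h = refl
⇒fresh x b (y ∷ c) h with b zero in b₀ | x Fin.≟ y
... | true  | yes x≡y = ⊥-elim (h zero b₀ x≡y)
... | true  | no _    = ⇒fresh x (b ∘ suc) c (h ∘ suc)
... | false | _       = ⇒fresh x (b ∘ suc) c (h ∘ suc)

freshAfter⇒ : ∀ {n N} u (b : Fin N → Bool) (c : Vec (Fin n) N) → freshAfter u b c ≡ true →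
              ∀ j → u < j → b j ≡ true → lookup c u ≢ lookup c j
freshAfter⇒ zero    b (y ∷ c) f (suc j) _         bj = fresh⇒ y (b ∘ suc) c f j bj
freshAfter⇒ (suc u) b (y ∷ c) f (suc j) (s≤s u<j) bj = freshAfter⇒ u (b ∘ suc) c f j u<j bj

⇒freshAfter : ∀ {n N} u (b : Fin N → Bool) (c : Vec (Fin n) N) →
              (∀ j → u < j → b j ≡ true → lookup c u ≢ lookup c j) → freshAfter u b c ≡ true
⇒freshAfter zero    b (y ∷ c) h = ⇒fresh y (b ∘ suc) c (λ j → h (suc j) (s≤s z≤n))
⇒freshAfter (suc u) b (y ∷ c) h = ⇒freshAfter u (b ∘ suc) c (λ j u<j → h (suc j) (s≤s u<j))

-- Every colour used on the vertices marked by b is counted at its last occurrence.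
∑-fresh : ∀ {n N} (b : Fin N → Bool) (c : Vec (Fin n) N) →
          ∑ (fin n) (λ x → fresh x b c ▷ 1ℚ) ≡ fromℕ n - ∑ (fin N) (λ u → b u ▷ freshAfter u b c ▷ 1ℚ)
∑-fresh {n} b []      = trans (∑-const n 1ℚ) (lem (fromℕ n))
  where
  lem : ∀ x → x * 1ℚ ≡ x - 0ℚ
  lem = solve 1 (λ x → x :* con 1ℚ := x :- con 0ℚ) refl
∑-fresh {n} {suc N} b (y ∷ c) = begin
  ∑ (fin n) (λ x → fresh x b (y ∷ c) ▷ 1ℚ)
    ≡⟨ ∑-cong (fin n) split ⟩
  ∑ (fin n) (λ x → (F x ▷ 1ℚ) - (b zero ▷ does (x Fin.≟ y) ▷ F x ▷ 1ℚ))
    ≡⟨ ∑-- (fin n) (λ x → F x ▷ 1ℚ) _ ⟩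
  ∑ (fin n) (λ x → F x ▷ 1ℚ) - ∑ (fin n) (λ x → b zero ▷ does (x Fin.≟ y) ▷ F x ▷ 1ℚ)
    -- Only the colour `x = y` survives in the second sum, and `F y` is `freshAfter zero b (y ∷ c)`.
    ≡⟨ cong₂ _-_ (∑-fresh (b ∘ suc) c) (trans (∑-▷ (fin n) (b zero) _) (cong (b zero ▷_) (∑-δ y _))) ⟩
  (fromℕ n - rest) - (b zero ▷ F y ▷ 1ℚ)
    ≡⟨ lem (fromℕ n) rest (b zero ▷ F y ▷ 1ℚ) ⟩
  fromℕ n - ((b zero ▷ F y ▷ 1ℚ) + rest) ∎
  where
  open ≡-Reasoning
  F : Fin n → Bool
  F x = fresh x (b ∘ suc) c
  rest : ℚ
  rest = ∑ (fin N) (λ u → b (suc u) ▷ freshAfter u (b ∘ suc) c ▷ 1ℚ)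
  lem : ∀ p q r → (p - q) - r ≡ p - (r + q)
  lem = solve 3 (λ p q r → (p :- q) :- r := p :- (r :+ q)) refl
  split : ∀ x → fresh x b (y ∷ c) ▷ 1ℚ ≡ (F x ▷ 1ℚ) - (b zero ▷ does (x Fin.≟ y) ▷ F x ▷ 1ℚ)
  split x with b zero | does (x Fin.≟ y)
  ... | true  | true  = sym (ℚ.+-inverseʳ (F x ▷ 1ℚ))
  ... | true  | false = sym (ℚ.+-identityʳ _)
  ... | false | _     = sym (ℚ.+-identityʳ _)

proper-∷ : ∀ {n N} (R : Adj (suc N)) (x : Fin n) c →
           does (proper? R (x ∷ c)) ≡ does (proper? (deleteZero R) c) ∧ fresh x (nb R) c
proper-∷ R x c = ⇔⇒≡ to from
  where
  to : does (proper? R (x ∷ c)) ≡ true → does (proper? (deleteZero R) c) ∧ fresh x (nb R) c ≡ true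
  to e with p ← does⇒ (proper? R (x ∷ c)) e =
    cong₂ _∧_ (dec-true (proper? (deleteZero R) c) (λ i j i≢j → p (suc i) (suc j) (i≢j ∘ Fin.suc-injective)))
              (⇒fresh x (nb R) c fr)
    where
    fr : ∀ j → nb R j ≡ true → x ≢ lookup c j
    fr j h with ∨-true h
    ... | inj₁ r = p zero (suc j) (λ ()) r
    ... | inj₂ r = p (suc j) zero (λ ()) r ∘ sym
  from : does (proper? (deleteZero R) c) ∧ fresh x (nb R) c ≡ true → does (proper? R (x ∷ c)) ≡ true
  from e with e₁ , e₂ ← ∧-true e | p ← does⇒ (proper? (deleteZero R) c) (proj₁ (∧-true e)) =
    dec-true (proper? R (x ∷ c)) pr
    where
    pr : Proper R (x ∷ c)
    pr zero    zero    i≢j _ = ⊥-elim (i≢j refl)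
    pr zero    (suc j) i≢j r = fresh⇒ x (nb R) c e₂ j (cong (_∨ R (suc j) zero) r)
    pr (suc i) zero    i≢j r = fresh⇒ x (nb R) c e₂ i (∨-introʳ r) ∘ sym
    pr (suc i) (suc j) i≢j r = p i j (i≢j ∘ cong suc) r

proper-merge : ∀ {n N} (R : Adj (suc N)) (u : Fin N) (c : Vec (Fin n) N) →
               does (proper? (deleteZero R) c) ∧ freshAfter u (nb R) c ≡ does (proper? (merge R u) c)
proper-merge R u c = ⇔⇒≡ to from
  where
  to : does (proper? (deleteZero R) c) ∧ freshAfter u (nb R) c ≡ true → does (proper? (merge R u) c) ≡ true
  to e with e₁ , e₂ ← ∧-true e | p ← does⇒ (proper? (deleteZero R) c) (proj₁ (∧-true e)) =
    dec-true (proper? (merge R u) c) pr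
    where
    pr : Proper (merge R u) c
    pr i j i≢j m with ∨-true m
    ... | inj₁ r = p i j i≢j r
    ... | inj₂ m′ with i≡u , m″ ← ∧-true m′ with u<j , nbj ← ∧-true m″
      with refl ← does⇒ (i Fin.≟ u) i≡u =
      freshAfter⇒ u (nb R) c e₂ j (does⇒ (u <? j) u<j) nbj
  from : does (proper? (merge R u) c) ≡ true → does (proper? (deleteZero R) c) ∧ freshAfter u (nb R) c ≡ true
  from e with p ← does⇒ (proper? (merge R u) c) e =
    cong₂ _∧_ (dec-true (proper? (deleteZero R) c) (λ i j i≢j r → p i j i≢j (∨-introˡ r)))
      (⇒freshAfter u (nb R) c λ j u<j nbj →
        p u j (Fin.<⇒≢ u<j)
          (∨-introʳ (cong₂ _∧_ (dec-true (u Fin.≟ u) refl) (cong₂ _∧_ (dec-true (u <? j) u<j) nbj))))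

colourings-suc : ∀ n N (R : Adj (suc N)) → colourings n (suc N) R ≡
  fromℕ n * colourings n N (deleteZero R) - ∑ (fin N) (λ u → nb R u ▷ colourings n N (merge R u))
colourings-suc n N R = begin
  ∑ (fin n) (λ x → ∑ cs (λ c → does (proper? R (x ∷ c)) ▷ 1ℚ))
    ≡⟨ ∑-comm (fin n) cs _ ⟩
  ∑ cs (λ c → ∑ (fin n) (λ x → does (proper? R (x ∷ c)) ▷ 1ℚ))
    ≡⟨ ∑-cong cs inner ⟩
  ∑ cs (λ c → fromℕ n * (p c ▷ 1ℚ) - ∑ (fin N) (λ u → nb R u ▷ does (proper? (merge R u) c) ▷ 1ℚ))
    ≡⟨ ∑-- cs _ _ ⟩
  ∑ cs (λ c → fromℕ n * (p c ▷ 1ℚ)) - ∑ cs (λ c → ∑ (fin N) (λ u → nb R u ▷ does (proper? (merge R u) c) ▷ 1ℚ))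
    ≡⟨ cong₂ _-_ (∑-* cs (fromℕ n) _)
                 (trans (∑-comm cs (fin N) _) (∑-cong (fin N) λ u → ∑-▷ cs (nb R u) _)) ⟩
  fromℕ n * colourings n N (deleteZero R) - ∑ (fin N) (λ u → nb R u ▷ colourings n N (merge R u)) ∎
  where
  open ≡-Reasoning
  cs : Code
  cs = vec (fin n) N
  p : Vec (Fin n) N → Bool
  p c = does (proper? (deleteZero R) c)
  expand : ∀ b y z → b ▷ (y - z) ≡ y * (b ▷ 1ℚ) - (b ▷ z)
  expand true  y z = cong (_- z) (sym (ℚ.*-identityʳ y))
  expand false y z = lem y
    where
    lem : ∀ y → 0ℚ ≡ y * 0ℚ - 0ℚ
    lem = solve 1 (λ y → con 0ℚ := y :* con 0ℚ :- con 0ℚ) refl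
  inner : ∀ c → ∑ (fin n) (λ x → does (proper? R (x ∷ c)) ▷ 1ℚ) ≡
                fromℕ n * (p c ▷ 1ℚ) - ∑ (fin N) (λ u → nb R u ▷ does (proper? (merge R u) c) ▷ 1ℚ)
  inner c = begin
    ∑ (fin n) (λ x → does (proper? R (x ∷ c)) ▷ 1ℚ)
      ≡⟨ ∑-cong (fin n) (λ x → trans (cong (_▷ 1ℚ) (proper-∷ R x c)) (▷-∧ (p c) _ 1ℚ)) ⟩
    ∑ (fin n) (λ x → p c ▷ fresh x (nb R) c ▷ 1ℚ)
      ≡⟨ ∑-▷ (fin n) (p c) _ ⟩
    p c ▷ ∑ (fin n) (λ x → fresh x (nb R) c ▷ 1ℚ)
      ≡⟨ cong (p c ▷_) (∑-fresh (nb R) c) ⟩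
    p c ▷ (fromℕ n - ∑ (fin N) (λ u → nb R u ▷ freshAfter u (nb R) c ▷ 1ℚ))
      ≡⟨ expand (p c) (fromℕ n) _ ⟩
    fromℕ n * (p c ▷ 1ℚ) - (p c ▷ ∑ (fin N) (λ u → nb R u ▷ freshAfter u (nb R) c ▷ 1ℚ))
      ≡⟨ cong (λ z → fromℕ n * (p c ▷ 1ℚ) - z) (trans (sym (∑-▷ (fin N) (p c) _)) (∑-cong (fin N) λ u →
           trans (▷-comm (p c) (nb R u) _) (cong (nb R u ▷_)
             (trans (sym (▷-∧ (p c) _ 1ℚ)) (cong (_▷ 1ℚ) (proper-merge R u c)))))) ⟩
    fromℕ n * (p c ▷ 1ℚ) - ∑ (fin N) (λ u → nb R u ▷ does (proper? (merge R u) c) ▷ 1ℚ) ∎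

chromatic : ∀ n N (R : Adj N) → colourings n N R ≡ eval (fromTop (λ r → C r N R) N) (fromℕ n)
chromatic n zero    R = sym (trans (cong (1ℚ +_) (ℚ.*-zeroʳ (fromℕ n))) (ℚ.+-identityʳ 1ℚ))
chromatic n (suc N) R = begin
  colourings n (suc N) R
    ≡⟨ colourings-suc n N R ⟩
  x * colourings n N (deleteZero R) - ∑ (fin N) (λ u → nb R u ▷ colourings n N (merge R u))
    ≡⟨ cong₂ _-_ (cong (x *_) (chromatic n N (deleteZero R)))
                 (∑-cong (fin N) λ u → cong (nb R u ▷_) (chromatic n N (merge R u))) ⟩
  x * eval (fromTop a N) x - ∑ (fin N) (λ u → nb R u ▷ eval (fromTop (λ r → C r N (merge R u)) N) x)
    -- Multiplication by x prepends the constant term 0, which equals `C (suc N) N (deleteZero R)`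
    -- by `C-vanish`.
    ≡⟨ cong₂ _-_ (sym (trans (cong (_+ x * eval (fromTop a N) x) (C-vanish (suc N) N (deleteZero R) ℕ.≤-refl)) (ℚ.+-identityˡ (x * eval (fromTop a N) x))))
                 (sym (eval-fromTop-∑ (fin N) (nb R) (λ u r → C r N (merge R u)) x N)) ⟩
  eval (fromTop a (suc N)) x - eval (fromTop b N) x
    ≡⟨ eval-fromTop-shift a b (λ r → C r (suc N) R) x refl (λ r → refl) N ⟨
  eval (fromTop (λ r → C r (suc N) R) (suc N)) x ∎
  where
  open ≡-Reasoning
  x : ℚ
  x = fromℕ n
  a b : ℕ → ℚ
  a r = C r N (deleteZero R)
  b r = ∑ (fin N) (λ u → nb R u ▷ C r N (merge R u))

-- Multilinear set functions

SetFn : ℕ → Set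
SetFn N = Vec Bool N → ℚ

∂ : ∀ {N} → Fin N → SetFn N → SetFn N
∂ u f S = f (S [ u ]≔ true) - f (S [ u ]≔ false)

without : ∀ {N} → SetFn (suc N) → SetFn N
without f S = f (false ∷ S)

-- The derivative `∂ zero` with its dead coordinate dropped. Recursion on N uses `∂₀`; iterating
-- over arbitrary tuples needs `∂`, which keeps the domain.
∂₀ : ∀ {N} → SetFn (suc N) → SetFn N
∂₀ f S = f (true ∷ S) - f (false ∷ S)

-- The degree of f as a multilinear polynomial in the indicators of the elements of S.
DegLt : ℕ → ∀ N → SetFn N → Set
DegLt zero    N       f = ∀ S → f S ≡ 0ℚ
DegLt (suc d) zero    f = ⊤
DegLt (suc d) (suc N) f = DegLt (suc d) N (without f) × DegLt d N (∂₀ f)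

DegLt-ext : ∀ d N {f g : SetFn N} → (∀ S → f S ≡ g S) → DegLt d N f → DegLt d N g
DegLt-ext zero    N       e h       = λ S → trans (sym (e S)) (h S)
DegLt-ext (suc d) zero    e h       = tt
DegLt-ext (suc d) (suc N) e (h , k) =
  DegLt-ext (suc d) N (λ S → e (false ∷ S)) h ,
  DegLt-ext d N (λ S → cong₂ _-_ (e (true ∷ S)) (e (false ∷ S))) k

DegLt-0 : ∀ d N → DegLt d N (λ _ → 0ℚ)
DegLt-0 zero    N       = λ _ → refl
DegLt-0 (suc d) zero    = tt
DegLt-0 (suc d) (suc N) = DegLt-0 (suc d) N , DegLt-0 d N

DegLt-const : ∀ d N x → DegLt (suc d) N (λ _ → x)
DegLt-const d zero    x = tt
DegLt-const d (suc N) x =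
  DegLt-const d N x , DegLt-ext d N (λ _ → sym (ℚ.+-inverseʳ x)) (DegLt-0 d N)

DegLt-suc : ∀ d N {f : SetFn N} → DegLt d N f → DegLt (suc d) N f
DegLt-suc zero    N       h       = DegLt-ext 1 N (λ S → sym (h S)) (DegLt-0 1 N)
DegLt-suc (suc d) zero    h       = tt
DegLt-suc (suc d) (suc N) (h , k) = DegLt-suc (suc d) N h , DegLt-suc d N k

DegLt-+ : ∀ d N {f g : SetFn N} → DegLt d N f → DegLt d N g → DegLt d N (λ S → f S + g S)
DegLt-+ zero    N       h h′ = λ S → cong₂ _+_ (h S) (h′ S)
DegLt-+ (suc d) zero    h h′ = tt
DegLt-+ (suc d) (suc N) {f} {g} (h , k) (h′ , k′) =
  DegLt-+ (suc d) N h h′ ,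
  DegLt-ext d N (λ S → lem (f (true ∷ S)) (f (false ∷ S)) (g (true ∷ S)) (g (false ∷ S))) (DegLt-+ d N k k′)
  where
  lem : ∀ p q r s → (p - q) + (r - s) ≡ (p + r) - (q + s)
  lem = solve 4 (λ p q r s → (p :- q) :+ (r :- s) := (p :+ r) :- (q :+ s)) refl

DegLt-* : ∀ d N a {f : SetFn N} → DegLt d N f → DegLt d N (λ S → a * f S)
DegLt-* zero    N       a h = λ S → trans (cong (a *_) (h S)) (ℚ.*-zeroʳ a)
DegLt-* (suc d) zero    a h = tt
DegLt-* (suc d) (suc N) a {f} (h , k) =
  DegLt-* (suc d) N a h ,
  DegLt-ext d N (λ S → lem a (f (true ∷ S)) (f (false ∷ S))) (DegLt-* d N a k)
  where
  lem : ∀ a p q → a * (p - q) ≡ a * p - a * q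
  lem = solve 3 (λ a p q → a :* (p :- q) := a :* p :- a :* q) refl

DegLt-∑ : ∀ d N n {f : Fin n → SetFn N} → (∀ i → DegLt d N (f i)) → DegLt d N (λ S → ∑ (fin n) (λ i → f i S))
DegLt-∑ d N zero    h = DegLt-0 d N
DegLt-∑ d N (suc n) h = DegLt-+ d N (h zero) (DegLt-∑ d N n (h ∘ suc))

DegLt-▷ : ∀ d N b {f : SetFn N} → DegLt d N f → DegLt d N (λ S → b ▷ f S)
DegLt-▷ d N true  h = h
DegLt-▷ d N false h = DegLt-0 d N

DegLt-member : ∀ d N u {f : SetFn N} → DegLt d N f → DegLt (suc d) N (λ S → lookup S u ▷ f S)
DegLt-member zero    N       u {f} h =
  DegLt-ext 1 N (λ S → sym (trans (cong (lookup S u ▷_) (h S)) (▷-0 (lookup S u)))) (DegLt-0 1 N)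
-- Write f = p + x₀ p′. As x₀² = x₀, the product x₀ f is x₀ (p + p′): it has no part without x₀, and
-- its derivative is p + p′.
DegLt-member (suc d) (suc N) zero {f} (h , k) =
  DegLt-0 (suc (suc d)) N ,
  DegLt-ext (suc d) N (λ S → lem (f (true ∷ S)) (f (false ∷ S))) (DegLt-+ (suc d) N h (DegLt-suc d N k))
  where
  lem : ∀ p q → q + (p - q) ≡ p - 0ℚ
  lem = solve 2 (λ p q → q :+ (p :- q) := p :- con 0ℚ) refl
DegLt-member (suc d) (suc N) (suc u) {f} (h , k) =
  DegLt-member (suc d) N u h ,
  DegLt-ext (suc d) N (λ S → lem (lookup S u) (f (true ∷ S)) (f (false ∷ S))) (DegLt-member d N u k)
  where
  lem : ∀ b p q → b ▷ (p - q) ≡ (b ▷ p) - (b ▷ q)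
  lem true  p q = refl
  lem false p q = refl

restrict : ∀ {N} → Adj N → Vec Bool N → Adj N
restrict R S i j = R i j ∧ lookup S i ∧ lookup S j

-- This is 2r + 1, since `DegLt` is a strict bound.
degreeBound : ℕ → ℕ
degreeBound zero    = 1
degreeBound (suc r) = suc (suc (degreeBound r))

-- Restriction commutes with merge R u for u in S, so one step of the recursion costs two
-- degrees: one for the difference at the vertex zero, one for the indicator of u.
C-degree : ∀ r N (R : Adj N) → DegLt (degreeBound r) N (λ S → C r N (restrict R S))
C-degree zero    N       R = DegLt-const 0 N 1ℚ
C-degree (suc r) zero    R = tt
C-degree (suc r) (suc N) R =
  DegLt-ext (degreeBound (suc r)) N (λ S → sym (absent S)) (C-degree (suc r) N (deleteZero R)) ,
  DegLt-ext (suc (degreeBound r)) N (λ S → sym (difference S))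
    (DegLt-* (suc (degreeBound r)) N (- 1ℚ) (DegLt-∑ (suc (degreeBound r)) N N λ u →
      DegLt-▷ (suc (degreeBound r)) N (nb R u) (DegLt-member (degreeBound r) N u (C-degree r N (merge R u)))))
  where
  open ≡-Reasoning
  nb-false : ∀ a b c → (a ∧ false ∧ c) ∨ (b ∧ c ∧ false) ≡ false
  nb-false false b     c     = trans (cong (b ∧_) (∧-zeroʳ c)) (∧-zeroʳ b)
  nb-false true  b     c     = trans (cong (b ∧_) (∧-zeroʳ c)) (∧-zeroʳ b)
  nb-true : ∀ a b c → (a ∧ true ∧ c) ∨ (b ∧ c ∧ true) ≡ (a ∨ b) ∧ c
  nb-true true  b true  = refl
  nb-true true  b false = ∧-zeroʳ b
  nb-true false b c     = cong (b ∧_) (∧-identityʳ c)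
  rest : Vec Bool N → ℚ
  rest S = C (suc r) N (restrict (deleteZero R) S)
  absent : ∀ S → C (suc r) (suc N) (restrict R (false ∷ S)) ≡ rest S
  absent S = begin
    rest S - ∑ (fin N) (λ u → nb (restrict R (false ∷ S)) u ▷ C r N (merge (restrict R (false ∷ S)) u))
      ≡⟨ cong (λ x → rest S - x) (trans (∑-cong (fin N) λ u →
           cong (_▷ C r N (merge (restrict R (false ∷ S)) u)) (nb-false (R zero (suc u)) (R (suc u) zero) (lookup S u)))
           (∑-0 (fin N))) ⟩
    rest S - 0ℚ
      ≡⟨ ℚ.+-identityʳ (rest S) ⟩
    rest S ∎
  -- For `u` outside `S` this can fail, because the left side still joins `u` to later neighbours in
  -- `S`; but such a `u` is no neighbour of the vertex zero after the restriction.
  merge-restrict : ∀ S u → lookup S u ≡ true → ∀ i j →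
                   merge (restrict R (true ∷ S)) u i j ≡ restrict (merge R u) S i j
  merge-restrict S u Su i j rewrite nb-true (R zero (suc j)) (R (suc j) zero) (lookup S j) with i Fin.≟ u
  ... | yes refl rewrite Su = lem (R (suc i) (suc j)) (does (u <? j)) (nb R j) (lookup S j)
    where
    lem : ∀ a b c s → (a ∧ true ∧ s) ∨ (b ∧ c ∧ s) ≡ (a ∨ (b ∧ c)) ∧ true ∧ s
    lem true  b     c     true  = refl
    lem true  true  c     false = ∧-zeroʳ c
    lem true  false c     false = refl
    lem false true  c     s     = refl
    lem false false c     s     = refl
  ... | no _ = lem (R (suc i) (suc j)) (lookup S i ∧ lookup S j)
    where
    lem : ∀ a s → (a ∧ s) ∨ false ≡ (a ∨ false) ∧ s
    lem true  true  = refl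
    lem true  false = refl
    lem false s     = refl
  present : ∀ S u → nb (restrict R (true ∷ S)) u ▷ C r N (merge (restrict R (true ∷ S)) u) ≡
                    nb R u ▷ lookup S u ▷ C r N (restrict (merge R u) S)
  present S u = begin
    nb (restrict R (true ∷ S)) u ▷ C r N (merge (restrict R (true ∷ S)) u)
      ≡⟨ cong (_▷ C r N (merge (restrict R (true ∷ S)) u)) (nb-true (R zero (suc u)) (R (suc u) zero) (lookup S u)) ⟩
    (nb R u ∧ lookup S u) ▷ C r N (merge (restrict R (true ∷ S)) u)
      ≡⟨ ▷-∧ (nb R u) (lookup S u) _ ⟩
    nb R u ▷ lookup S u ▷ C r N (merge (restrict R (true ∷ S)) u)
      ≡⟨ cong (nb R u ▷_) (under (lookup S u) refl) ⟩
    nb R u ▷ lookup S u ▷ C r N (restrict (merge R u) S) ∎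
    where
    under : ∀ b → lookup S u ≡ b →
            b ▷ C r N (merge (restrict R (true ∷ S)) u) ≡ b ▷ C r N (restrict (merge R u) S)
    under true  Su = C-ext r N (merge-restrict S u Su)
    under false Su = refl
  difference : ∀ S → C (suc r) (suc N) (restrict R (true ∷ S)) - C (suc r) (suc N) (restrict R (false ∷ S)) ≡
    (- 1ℚ) * ∑ (fin N) (λ u → nb R u ▷ lookup S u ▷ C r N (restrict (merge R u) S))
  difference S = trans (cong₂ (λ x y → (rest S - x) - y) (∑-cong (fin N) (present S)) (absent S))
                       (lem (rest S) _)
    where
    lem : ∀ x y → (x - y) - x ≡ (- 1ℚ) * y
    lem = solve 2 (λ x y → (x :- y) :- x := con (- 1ℚ) :* y) refl

-- T N s f is the sum of the coefficients of the monomials of degree s of the multilinear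
-- polynomial f.
T : ∀ N → ℕ → SetFn N → ℚ
T zero    zero    f = f []
T zero    (suc s) f = 0ℚ
T (suc N) zero    f = T N zero (without f)
T (suc N) (suc s) f = T N (suc s) (without f) + T N s (∂₀ f)

full : ∀ {N} → Vec Bool N
full = replicate _ true

empty : ∀ {N} → Vec Bool N
empty = replicate _ false

-- Every monomial has the value 1 at the all-ones point, so the value there is the sum of all
-- coefficients, grouped by degree.
value-at-full : ∀ d N f → DegLt d N f → f full ≡ ∑ (fin d) (λ s → T N (toℕ s) f)
value-at-full zero    N       f h       = h full
value-at-full (suc d) zero    f h       =
  sym (trans (cong (f [] +_) (∑-0 (fin d))) (ℚ.+-identityʳ (f [])))
value-at-full (suc d) (suc N) f (h , k) = begin
  f (true ∷ full)
    ≡⟨ split (f (true ∷ full)) (f (false ∷ full)) ⟩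
  without f full + ∂₀ f full
    ≡⟨ cong₂ _+_ (value-at-full (suc d) N (without f) h) (value-at-full d N (∂₀ f) k) ⟩
  (T N 0 (without f) + ∑ (fin d) (λ s → T N (suc (toℕ s)) (without f))) + ∑ (fin d) (λ s → T N (toℕ s) (∂₀ f))
    ≡⟨ ℚ.+-assoc (T N 0 (without f)) _ _ ⟩
  T N 0 (without f) + (∑ (fin d) (λ s → T N (suc (toℕ s)) (without f)) + ∑ (fin d) (λ s → T N (toℕ s) (∂₀ f)))
    ≡⟨ cong (T N 0 (without f) +_) (∑-+ (fin d) _ _) ⟨
  T N 0 (without f) + ∑ (fin d) (λ s → T N (suc (toℕ s)) (without f) + T N (toℕ s) (∂₀ f)) ∎
  where
  open ≡-Reasoning
  split : ∀ p q → p ≡ q + (p - q)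
  split = solve 2 (λ p q → p := q :+ (p :- q)) refl

D : ∀ {N s} → Vec (Fin N) s → SetFn N → SetFn N
D []      f = f
D (u ∷ v) f = D v (∂ u f)

D-ext : ∀ {N s} (v : Vec (Fin N) s) {f g : SetFn N} → (∀ S → f S ≡ g S) → ∀ S → D v f S ≡ D v g S
D-ext []      e = e
D-ext (u ∷ v) e = D-ext v (λ S → cong₂ _-_ (e (S [ u ]≔ true)) (e (S [ u ]≔ false)))

D-0 : ∀ {N s} (v : Vec (Fin N) s) {f : SetFn N} → (∀ S → f S ≡ 0ℚ) → ∀ S → D v f S ≡ 0ℚ
D-0 []      e = e
D-0 (u ∷ v) e = D-0 v (λ S → cong₂ _-_ (e (S [ u ]≔ true)) (e (S [ u ]≔ false)))

∑D : ∀ N s → SetFn N → ℚ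
∑D N s f = ∑ (vec (fin N) s) (λ v → D v f empty)

∑D-ext : ∀ N s {f g : SetFn N} → (∀ S → f S ≡ g S) → ∑D N s f ≡ ∑D N s g
∑D-ext N s e = ∑-cong (vec (fin N) s) (λ v → D-ext v e empty)

∑D-0 : ∀ N s {f : SetFn N} → (∀ S → f S ≡ 0ℚ) → ∑D N s f ≡ 0ℚ
∑D-0 N s e = trans (∑-cong (vec (fin N) s) (λ v → D-0 v e empty)) (∑-0 (vec (fin N) s))

-- Tuples that avoid the vertex zero give the first term. Tuples that contain it once give the
-- second, with `suc s` positions for it. Tuples that contain it twice contribute nothing, as a
-- repeated derivative vanishes. The induction on s splits off the first entry, and `mixed` collects
-- the tuples with zero among the later ones.
∑D-suc : ∀ N s f → ∑D (suc N) (suc s) f ≡ ∑D N (suc s) (without f) + fromℕ (suc s) * ∑D N s (∂₀ f)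

∑D-suc N s f = begin
  ∑D (suc N) s (∂ zero f) + ∑ (fin N) (λ u → ∑D (suc N) s (∂ (suc u) f))
    ≡⟨ cong₂ _+_ (first s) (∑-cong (fin N) (others s)) ⟩
  ∑D N s (∂₀ f) + ∑ (fin N) (λ u → ∑D N s (∂ u (without f)) + mixed s u)
    ≡⟨ cong (∑D N s (∂₀ f) +_) (trans (∑-+ (fin N) _ (mixed s)) (cong (∑D N (suc s) (without f) +_) (∑-mixed s))) ⟩
  ∑D N s (∂₀ f) + (∑D N (suc s) (without f) + fromℕ s * ∑D N s (∂₀ f))
    ≡⟨ lem (∑D N s (∂₀ f)) (∑D N (suc s) (without f)) (fromℕ s) ⟩
  ∑D N (suc s) (without f) + (1ℚ + fromℕ s) * ∑D N s (∂₀ f)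
    ≡⟨ cong (λ x → ∑D N (suc s) (without f) + x * ∑D N s (∂₀ f)) (fromℕ-suc s) ⟨
  ∑D N (suc s) (without f) + fromℕ (suc s) * ∑D N s (∂₀ f) ∎
  where
  open ≡-Reasoning
  lem : ∀ p q r → p + (q + r * p) ≡ q + (1ℚ + r) * p
  lem = solve 3 (λ p q r → p :+ (q :+ r :* p) := q :+ (con 1ℚ :+ r) :* p) refl
  first : ∀ s → ∑D (suc N) s (∂ zero f) ≡ ∑D N s (∂₀ f)
  first zero    = refl
  first (suc s) = begin
    ∑D (suc N) (suc s) (∂ zero f)
      ≡⟨ ∑D-suc N s (∂ zero f) ⟩
    ∑D N (suc s) (∂₀ f) + fromℕ (suc s) * ∑D N s (∂₀ (∂ zero f))
      ≡⟨ cong (λ x → ∑D N (suc s) (∂₀ f) + fromℕ (suc s) * x)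
           (∑D-0 N s (λ S → ℚ.+-inverseʳ (∂₀ f S))) ⟩
    ∑D N (suc s) (∂₀ f) + fromℕ (suc s) * 0ℚ
      ≡⟨ lem₀ (∑D N (suc s) (∂₀ f)) (fromℕ (suc s)) ⟩
    ∑D N (suc s) (∂₀ f) ∎
    where
    lem₀ : ∀ p q → p + q * 0ℚ ≡ p
    lem₀ = solve 2 (λ p q → p :+ q :* con 0ℚ := p) refl
  mixed : ℕ → Fin N → ℚ
  mixed zero    u = 0ℚ
  mixed (suc s) u = fromℕ (suc s) * ∑D N s (∂ u (∂₀ f))
  others : ∀ s u → ∑D (suc N) s (∂ (suc u) f) ≡ ∑D N s (∂ u (without f)) + mixed s u
  others zero    u = sym (ℚ.+-identityʳ _)
  others (suc s) u = trans (∑D-suc N s (∂ (suc u) f))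
    (cong (λ x → ∑D N (suc s) (∂ u (without f)) + fromℕ (suc s) * x)
      (∑D-ext N s (λ S → commute (f (true ∷ (S [ u ]≔ true))) (f (true ∷ (S [ u ]≔ false)))
                                 (f (false ∷ (S [ u ]≔ true))) (f (false ∷ (S [ u ]≔ false))))))
    where
    commute : ∀ p q r t → (p - q) - (r - t) ≡ (p - r) - (q - t)
    commute = solve 4 (λ p q r t → (p :- q) :- (r :- t) := (p :- r) :- (q :- t)) refl
  ∑-mixed : ∀ s → ∑ (fin N) (mixed s) ≡ fromℕ s * ∑D N s (∂₀ f)
  ∑-mixed zero    = trans (∑-0 (fin N)) (sym (ℚ.*-zeroˡ (∑D N 0 (∂₀ f))))
  ∑-mixed (suc s) = ∑-* (fin N) (fromℕ (suc s)) _

-- Each monomial of degree s is met once for every ordering of its s variables; at the empty set,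
-- `D v f` is the coefficient of the monomial on the entries of `v`, if these are distinct.
∑D-factorial : ∀ N s f → ∑D N s f ≡ fromℕ (s !) * T N s f
∑D-factorial zero    zero    f = sym (ℚ.*-identityˡ (f []))
∑D-factorial zero    (suc s) f = sym (ℚ.*-zeroʳ (fromℕ (suc s !)))
∑D-factorial (suc N) zero    f = ∑D-factorial N zero (without f)
∑D-factorial (suc N) (suc s) f = begin
  ∑D (suc N) (suc s) f
    ≡⟨ ∑D-suc N s f ⟩
  ∑D N (suc s) (without f) + fromℕ (suc s) * ∑D N s (∂₀ f)
    ≡⟨ cong₂ (λ x y → x + fromℕ (suc s) * y) (∑D-factorial N (suc s) (without f)) (∑D-factorial N s (∂₀ f)) ⟩
  fromℕ (suc s !) * T N (suc s) (without f) + fromℕ (suc s) * (fromℕ (s !) * T N s (∂₀ f))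
    ≡⟨ cong (λ x → fromℕ (suc s !) * T N (suc s) (without f) + x)
         (trans (sym (ℚ.*-assoc (fromℕ (suc s)) (fromℕ (s !)) (T N s (∂₀ f))))
                (cong (_* T N s (∂₀ f)) (sym (fromℕ-* (suc s) (s !))))) ⟩
  fromℕ (suc s !) * T N (suc s) (without f) + fromℕ (suc s !) * T N s (∂₀ f)
    ≡⟨ ℚ.*-distribˡ-+ (fromℕ (suc s !)) _ _ ⟨
  fromℕ (suc s !) * T (suc N) (suc s) f ∎
  where open ≡-Reasoning

-- Locality of the coefficients

infix 4 _∈ᵇ_

_∈ᵇ_ : ∀ {N s} → Fin N → Vec (Fin N) s → Bool
u ∈ᵇ []      = false
u ∈ᵇ (w ∷ v) = does (u Fin.≟ w) ∨ (u ∈ᵇ v)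

distinct : ∀ {N s} → Vec (Fin N) s → Bool
distinct []      = true
distinct (u ∷ v) = not (u ∈ᵇ v) ∧ distinct v

not-true : ∀ {b} → not b ≡ true → b ≡ false
not-true {false} _ = refl

∉ᵇ⇒≢ : ∀ {N s} {u : Fin N} (v : Vec (Fin N) s) → (u ∈ᵇ v) ≡ false → ∀ a → u ≢ lookup v a
∉ᵇ⇒≢ {u = u} (w ∷ v) e a with u Fin.≟ w
∉ᵇ⇒≢ (w ∷ v) e zero    | no u≢w = u≢w
∉ᵇ⇒≢ (w ∷ v) e (suc a) | no u≢w = ∉ᵇ⇒≢ v e a

distinct⇒injective : ∀ {N s} (v : Vec (Fin N) s) → distinct v ≡ true → ∀ {a b} → a ≢ b → lookup v a ≢ lookup v b
distinct⇒injective (u ∷ v) e {zero}  {zero}  a≢b = ⊥-elim (a≢b refl)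
distinct⇒injective (u ∷ v) e {zero}  {suc b} a≢b = ∉ᵇ⇒≢ v (not-true (proj₁ (∧-true e))) b
distinct⇒injective (u ∷ v) e {suc a} {zero}  a≢b = ∉ᵇ⇒≢ v (not-true (proj₁ (∧-true e))) a ∘ sym
distinct⇒injective (u ∷ v) e {suc a} {suc b} a≢b =
  distinct⇒injective v (proj₂ (∧-true {not (u ∈ᵇ v)} e)) (a≢b ∘ cong suc)

Independent : ∀ {N} → Fin N → SetFn N → Set
Independent u f = ∀ S b b′ → f (S [ u ]≔ b) ≡ f (S [ u ]≔ b′)

∂-independent : ∀ {N} (u : Fin N) f → Independent u (∂ u f)
∂-independent u f S b b′ = cong₂ _-_ (same true) (same false)
  where
  same : ∀ x → f ((S [ u ]≔ b) [ u ]≔ x) ≡ f ((S [ u ]≔ b′) [ u ]≔ x)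
  same x = cong f (trans ([]≔-idempotent S u) (sym ([]≔-idempotent S u)))

∂-preserves-independent : ∀ {N} (u w : Fin N) f → u ≢ w → Independent u f → Independent u (∂ w f)
∂-preserves-independent u w f u≢w ind S b b′ = cong₂ _-_ (same true) (same false)
  where
  same : ∀ x → f ((S [ u ]≔ b) [ w ]≔ x) ≡ f ((S [ u ]≔ b′) [ w ]≔ x)
  same x = trans (cong f ([]≔-commutes S u w u≢w))
                 (trans (ind (S [ w ]≔ x) b b′) (cong f (sym ([]≔-commutes S u w u≢w))))

D-independent : ∀ {N s} (u : Fin N) (v : Vec (Fin N) s) f → (u ∈ᵇ v) ≡ true → Independent u f →
                ∀ S → D v f S ≡ 0ℚ
D-independent u (w ∷ v) f u∈v ind with u Fin.≟ w
... | yes refl = D-0 v (λ S → trans (cong (_- f (S [ u ]≔ false)) (ind S true false)) (ℚ.+-inverseʳ (f (S [ u ]≔ false))))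
... | no  u≢w  = D-independent u v (∂ w f) u∈v (∂-preserves-independent u w f u≢w ind)

-- `∂ u f` does not depend on the coordinate `u`, derivatives in other directions keep it so, and
-- the second derivative along `u` is then zero.
D-repetition : ∀ {N s} (v : Vec (Fin N) s) f → distinct v ≡ false → ∀ S → D v f S ≡ 0ℚ
D-repetition (u ∷ v) f e with u ∈ᵇ v in u∈v
... | true  = D-independent u v (∂ u f) u∈v (∂-independent u f)
... | false = D-repetition v (∂ u f) e

-- The alternating sum over the cube, that is, the coefficient of the product of all s variables.
Δ : ∀ s → SetFn s → ℚ
Δ zero    g = g []
Δ (suc s) g = Δ s (∂₀ g)

Δ-cong : ∀ s {f g : SetFn s} → (∀ S → f S ≡ g S) → Δ s f ≡ Δ s g
Δ-cong zero    e = e []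
Δ-cong (suc s) e = Δ-cong s (λ S → cong₂ _-_ (e (true ∷ S)) (e (false ∷ S)))

-- Overwrites `S` on the entries of `v` by the bits `B`. The head is written last, which makes the
-- first difference of f ∘ `place` equal to `∂ u f` by computation.
place : ∀ {N s} → Vec Bool N → Vec (Fin N) s → Vec Bool s → Vec Bool N
place S []      []      = S
place S (u ∷ v) (b ∷ B) = place S v B [ u ]≔ b

D-as-Δ : ∀ {N s} (v : Vec (Fin N) s) f S → D v f S ≡ Δ s (λ B → f (place S v B))
D-as-Δ []      f S = refl
D-as-Δ (u ∷ v) f S = D-as-Δ v (∂ u f) S

lookup-place : ∀ {N s} S (v : Vec (Fin N) s) B → distinct v ≡ true →
               ∀ a → lookup (place S v B) (lookup v a) ≡ lookup B a
lookup-place S (u ∷ v) (b ∷ B) e zero    = lookup∘update u (place S v B) b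
lookup-place S (u ∷ v) (b ∷ B) e (suc a) =
  trans (lookup∘update′ (∉ᵇ⇒≢ v (not-true (proj₁ (∧-true e))) a ∘ sym) (place S v B) b)
        (lookup-place S v B (proj₂ (∧-true {not (u ∈ᵇ v)} e)) a)

place-empty : ∀ {N s} (v : Vec (Fin N) s) B i → lookup (place empty v B) i ≡ true →
              ∃[ a ] lookup v a ≡ i × lookup B a ≡ true
place-empty []      []      i e with () ← trans (sym e) (lookup-replicate i false)
place-empty (u ∷ v) (b ∷ B) i e with u Fin.≟ i
... | yes refl = zero , refl , trans (sym (lookup∘update u (place empty v B) b)) e
... | no u≢i with a , va≡i , Ba ← place-empty v B i (trans (sym (lookup∘update′ (u≢i ∘ sym) (place empty v B) b)) e) =
  suc a , va≡i , Ba

pull : ∀ {N s} → Adj N → Vec (Fin N) s → Adj s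
pull R v a b = R (lookup v a) (lookup v b)

-- All edges of the restricted graph join entries of `v`, so only the colours of these entries
-- matter.
proper-place : ∀ {n N s} (R : Adj N) (v : Vec (Fin N) s) B → distinct v ≡ true → (c : Vec (Fin n) N) →
  does (proper? (restrict R (place empty v B)) c) ≡ does (proper? (restrict (pull R v) B) (Vec.map (lookup c) v))
proper-place R v B dv c = ⇔⇒≡ to from
  where
  S : Vec Bool _
  S = place empty v B
  to : does (proper? (restrict R S) c) ≡ true → does (proper? (restrict (pull R v) B) (Vec.map (lookup c) v)) ≡ true
  to e with p ← does⇒ (proper? (restrict R S) c) e = dec-true (proper? _ (Vec.map (lookup c) v)) λ a b a≢b r eq →
    p (lookup v a) (lookup v b) (distinct⇒injective v dv a≢b)
      (trans (cong₂ (λ x y → R (lookup v a) (lookup v b) ∧ x ∧ y) (lookup-place empty v B dv a) (lookup-place empty v B dv b)) r)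
      (trans (sym (lookup-map a (lookup c) v)) (trans eq (lookup-map b (lookup c) v)))
  from : does (proper? (restrict (pull R v) B) (Vec.map (lookup c) v)) ≡ true → does (proper? (restrict R S) c) ≡ true
  from e with p ← does⇒ (proper? (restrict (pull R v) B) (Vec.map (lookup c) v)) e = dec-true (proper? (restrict R S) c) pr
    where
    pr : Proper (restrict R S) c
    pr i j i≢j r with Rij , SS ← ∧-true {R i j} r with Si , Sj ← ∧-true SS
      with place-empty v B i Si | place-empty v B j Sj
    ... | a , refl , Ba | b , refl , Bb = λ eq →
      p a b (i≢j ∘ cong (lookup v)) (cong₂ _∧_ Rij (cong₂ _∧_ Ba Bb))
        (trans (lookup-map a (lookup c) v) (trans eq (sym (lookup-map b (lookup c) v))))

infixr 8 _^ℚ_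

_^ℚ_ : ℚ → ℕ → ℚ
x ^ℚ zero  = 1ℚ
x ^ℚ suc n = x * x ^ℚ n

∑-vec-const : ∀ n N x → ∑ (vec (fin n) N) (λ _ → x) ≡ fromℕ n ^ℚ N * x
∑-vec-const n zero    x = sym (ℚ.*-identityˡ x)
∑-vec-const n (suc N) x = begin
  ∑ (fin n) (λ _ → ∑ (vec (fin n) N) (λ _ → x))  ≡⟨ ∑-const n _ ⟩
  fromℕ n * ∑ (vec (fin n) N) (λ _ → x)          ≡⟨ cong (fromℕ n *_) (∑-vec-const n N x) ⟩
  fromℕ n * (fromℕ n ^ℚ N * x)                   ≡⟨ ℚ.*-assoc (fromℕ n) _ x ⟨
  fromℕ n ^ℚ suc N * x                           ∎
  where open ≡-Reasoning

-- Among the pairs of a colouring and a new colour for `u`, every colouring arises n times.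
-- Multiplying instead of dividing by n covers n = 0.
resample : ∀ n {N} (u : Fin N) (G : Vec (Fin n) N → ℚ) →
  fromℕ n * ∑ (vec (fin n) N) G ≡ ∑ (fin n) (λ x → ∑ (vec (fin n) N) (λ c → G (c [ u ]≔ x)))
resample n {suc N} zero    G = begin
  fromℕ n * ∑ (fin n) (λ x → ∑ (vec (fin n) N) (λ c → G (x ∷ c)))
    ≡⟨ ∑-* (fin n) (fromℕ n) _ ⟨
  ∑ (fin n) (λ x → fromℕ n * ∑ (vec (fin n) N) (λ c → G (x ∷ c)))
    ≡⟨ ∑-cong (fin n) (λ x → ∑-const n _) ⟨
  ∑ (fin n) (λ x → ∑ (fin n) (λ y → ∑ (vec (fin n) N) (λ c → G (x ∷ c)))) ∎
  where open ≡-Reasoning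
resample n {suc N} (suc u) G = begin
  fromℕ n * ∑ (fin n) (λ y → ∑ (vec (fin n) N) (λ c → G (y ∷ c)))
    ≡⟨ ∑-* (fin n) (fromℕ n) _ ⟨
  ∑ (fin n) (λ y → fromℕ n * ∑ (vec (fin n) N) (λ c → G (y ∷ c)))
    ≡⟨ ∑-cong (fin n) (λ y → resample n u (λ c → G (y ∷ c))) ⟩
  ∑ (fin n) (λ y → ∑ (fin n) (λ x → ∑ (vec (fin n) N) (λ c → G (y ∷ (c [ u ]≔ x)))))
    ≡⟨ ∑-comm (fin n) (fin n) _ ⟩
  ∑ (fin n) (λ x → ∑ (fin n) (λ y → ∑ (vec (fin n) N) (λ c → G (y ∷ (c [ u ]≔ x))))) ∎
  where open ≡-Reasoning

map-update : ∀ {n N s} (c : Vec (Fin n) N) u x (v : Vec (Fin N) s) → (u ∈ᵇ v) ≡ false →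
             Vec.map (lookup (c [ u ]≔ x)) v ≡ Vec.map (lookup c) v
map-update c u x []      e = refl
map-update c u x (w ∷ v) e with u Fin.≟ w
... | no u≢w = cong₂ _∷_ (lookup∘update′ (u≢w ∘ sym) c x) (map-update c u x v e)

-- The colours on distinct vertices are uniformly distributed: the entries are resampled one at a
-- time, and recolouring one does not disturb the others. Powers of n on both sides avoid N - s and
-- division.
∑-pull : ∀ n {N s} (v : Vec (Fin N) s) → distinct v ≡ true → (F : Vec (Fin n) s → ℚ) →
  fromℕ n ^ℚ s * ∑ (vec (fin n) N) (λ c → F (Vec.map (lookup c) v)) ≡ fromℕ n ^ℚ N * ∑ (vec (fin n) s) F
∑-pull n {N} []      dv F = trans (ℚ.*-identityˡ _) (∑-vec-const n N (F []))
∑-pull n {N} {suc s} (u ∷ v) dv F = begin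
  (x * x ^ℚ s) * ∑ cs (λ c → F (lookup c u ∷ Vec.map (lookup c) v))
    ≡⟨ rotate x (x ^ℚ s) _ ⟩
  x ^ℚ s * (x * ∑ cs (λ c → F (lookup c u ∷ Vec.map (lookup c) v)))
    ≡⟨ cong (x ^ℚ s *_) (resample n u _) ⟩
  x ^ℚ s * ∑ (fin n) (λ y → ∑ cs (λ c → F (lookup (c [ u ]≔ y) u ∷ Vec.map (lookup (c [ u ]≔ y)) v)))
    ≡⟨ cong (x ^ℚ s *_) (∑-cong (fin n) λ y → ∑-cong cs λ c → cong F
         (cong₂ _∷_ (lookup∘update u c y) (map-update c u y v (not-true (proj₁ (∧-true dv)))))) ⟩
  x ^ℚ s * ∑ (fin n) (λ y → ∑ cs (λ c → F (y ∷ Vec.map (lookup c) v)))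
    ≡⟨ ∑-* (fin n) (x ^ℚ s) _ ⟨
  ∑ (fin n) (λ y → x ^ℚ s * ∑ cs (λ c → F (y ∷ Vec.map (lookup c) v)))
    ≡⟨ ∑-cong (fin n) (λ y → ∑-pull n v (proj₂ (∧-true {not (u ∈ᵇ v)} dv)) (λ d → F (y ∷ d))) ⟩
  ∑ (fin n) (λ y → x ^ℚ N * ∑ (vec (fin n) s) (λ d → F (y ∷ d)))
    ≡⟨ ∑-* (fin n) (x ^ℚ N) _ ⟩
  x ^ℚ N * ∑ (vec (fin n) (suc s)) F ∎
  where
  open ≡-Reasoning
  x : ℚ
  x = fromℕ n
  cs : Code
  cs = vec (fin n) N
  rotate : ∀ p q r → (p * q) * r ≡ q * (p * r)
  rotate = solve 3 (λ p q r → (p :* q) :* r := q :* (p :* r)) refl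

-- Polynomials determined by their values

*-zero-cancel : ∀ {x y} → x ≢ 0ℚ → x * y ≡ 0ℚ → y ≡ 0ℚ
*-zero-cancel {x} {y} x≢0 e = begin
  y                ≡⟨ ℚ.*-identityˡ y ⟨
  1ℚ * y           ≡⟨ cong (_* y) (ℚ.*-inverseˡ x) ⟨
  (1/ x * x) * y   ≡⟨ ℚ.*-assoc (1/ x) x y ⟩
  1/ x * (x * y)   ≡⟨ cong (1/ x *_) e ⟩
  1/ x * 0ℚ        ≡⟨ ℚ.*-zeroʳ (1/ x) ⟩
  0ℚ               ∎
  where
  open ≡-Reasoning
  instance x-nonZero = ≢-nonZero x≢0

fromℕ-suc≢0 : ∀ n → fromℕ (suc n) ≢ 0ℚ
fromℕ-suc≢0 n e with () ← fromℕ-injective {suc n} {0} e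

eval-zero : ∀ p x → (∀ i → coeff p i ≡ 0ℚ) → eval p x ≡ 0ℚ
eval-zero []      x h = refl
eval-zero (a ∷ p) x h = trans (cong₂ (λ y z → y + x * z) (h 0) (eval-zero p x (h ∘ suc))) (lem x)
  where
  lem : ∀ x → 0ℚ + x * 0ℚ ≡ 0ℚ
  lem = solve 1 (λ x → con 0ℚ :+ x :* con 0ℚ := con 0ℚ) refl

-- The quotient of a + x p(x) by x - t, which does not depend on a.
quotient : Poly → ℚ → Poly
quotient []      t = []
quotient (b ∷ p) t = eval (b ∷ p) t ∷ quotient p t

eval-quotient : ∀ a p t x → eval (a ∷ p) x ≡ eval (a ∷ p) t + (x - t) * eval (quotient p t) x
eval-quotient a []      t x = lem a t x
  where
  lem : ∀ a t x → a + x * 0ℚ ≡ (a + t * 0ℚ) + (x - t) * 0ℚ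
  lem = solve 3 (λ a t x → a :+ x :* con 0ℚ := (a :+ t :* con 0ℚ) :+ (x :- t) :* con 0ℚ) refl
eval-quotient a (b ∷ p) t x =
  trans (cong (λ y → a + x * y) (eval-quotient b p t x)) (lem a x t (eval (b ∷ p) t) (eval (quotient p t) x))
  where
  lem : ∀ a x t y z → a + x * (y + (x - t) * z) ≡ (a + t * y) + (x - t) * (y + x * z)
  lem = solve 5 (λ a x t y z → a :+ x :* (y :+ (x :- t) :* z) := (a :+ t :* y) :+ (x :- t) :* (y :+ x :* z)) refl

quotient-zero : ∀ p t → (∀ i → coeff (quotient p t) i ≡ 0ℚ) → ∀ i → coeff p i ≡ 0ℚ
quotient-zero []      t h i       = refl
quotient-zero (b ∷ p) t h (suc i) = quotient-zero p t (h ∘ suc) i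
quotient-zero (b ∷ p) t h zero    = begin
  b                 ≡⟨ lem b t ⟩
  b + t * 0ℚ        ≡⟨ cong (λ y → b + t * y) (eval-zero p t (quotient-zero p t (h ∘ suc))) ⟨
  b + t * eval p t  ≡⟨ h 0 ⟩
  0ℚ                ∎
  where
  open ≡-Reasoning
  lem : ∀ b t → b ≡ b + t * 0ℚ
  lem = solve 2 (λ b t → b := b :+ t :* con 0ℚ) refl

length-quotient : ∀ p t → List.length (quotient p t) ≡ List.length p
length-quotient []      t = refl
length-quotient (b ∷ p) t = cong suc (length-quotient p t)

-- Dividing by x - m leaves a shorter list that vanishes at all natural numbers beyond m, where x -
-- m is nonzero; so m moves in the induction. The quotient is no sublist of `p`, hence recursion on
-- the length `ℓ`.
vanishing⇒zero : ∀ ℓ p → List.length p ≡ ℓ → ∀ m → (∀ k → eval p (fromℕ (m ℕ.+ k)) ≡ 0ℚ) → ∀ i → coeff p i ≡ 0ℚ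
vanishing⇒zero ℓ       []      e m h i = refl
vanishing⇒zero (suc ℓ) (a ∷ p) e m h = result
  where
  t : ℚ
  t = fromℕ m
  at-t : eval (a ∷ p) t ≡ 0ℚ
  at-t = trans (cong (eval (a ∷ p) ∘ fromℕ) (sym (ℕ.+-identityʳ m))) (h 0)
  lem : ∀ x t → (t + x) - t ≡ x
  lem = solve 2 (λ x t → (t :+ x) :- t := x) refl
  q-vanishes : ∀ k → eval (quotient p t) (fromℕ (suc m ℕ.+ k)) ≡ 0ℚ
  q-vanishes k = *-zero-cancel (fromℕ-suc≢0 k) (begin
    fromℕ (suc k) * eval (quotient p t) x
      ≡⟨ cong (_* eval (quotient p t) x) (trans (cong (_- t) (trans (cong fromℕ (sym (ℕ.+-suc m k))) (fromℕ-+ m (suc k)))) (lem (fromℕ (suc k)) t)) ⟨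
    (x - t) * eval (quotient p t) x
      ≡⟨ ℚ.+-identityˡ _ ⟨
    0ℚ + (x - t) * eval (quotient p t) x
      ≡⟨ cong (_+ (x - t) * eval (quotient p t) x) at-t ⟨
    eval (a ∷ p) t + (x - t) * eval (quotient p t) x
      ≡⟨ eval-quotient a p t x ⟨
    eval (a ∷ p) x
      ≡⟨ trans (cong (eval (a ∷ p) ∘ fromℕ) (sym (ℕ.+-suc m k))) (h (suc k)) ⟩
    0ℚ ∎)
    where
    open ≡-Reasoning
    x : ℚ
    x = fromℕ (suc m ℕ.+ k)
  p-zero : ∀ i → coeff p i ≡ 0ℚ
  p-zero = quotient-zero p t (vanishing⇒zero ℓ (quotient p t)
             (trans (length-quotient p t) (ℕ.suc-injective e)) (suc m) q-vanishes)
  result : ∀ i → coeff (a ∷ p) i ≡ 0ℚ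
  result (suc i) = p-zero i
  result zero    = trans (trans (lem₀ a t) (cong (λ y → a + t * y) (sym (eval-zero p t p-zero)))) at-t
    where
    lem₀ : ∀ b t → b ≡ b + t * 0ℚ
    lem₀ = solve 2 (λ b t → b := b :+ t :* con 0ℚ) refl

coeff-fromTop : ∀ a N r → r ℕ.≤ N → coeff (fromTop a N) (N ℕ.∸ r) ≡ a r
coeff-fromTop a zero    zero    r≤N = refl
coeff-fromTop a (suc N) r r≤N with ℕ.m≤n⇒m<n∨m≡n r≤N
... | inj₁ (s≤s r≤N′) rewrite ℕ.+-∸-assoc 1 r≤N′ = coeff-fromTop a N r r≤N′
... | inj₂ refl       rewrite ℕ.n∸n≡0 N = refl

coeff-fromTop-above : ∀ a N i → N ℕ.< i → coeff (fromTop a N) i ≡ 0ℚ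
coeff-fromTop-above a zero    (suc i) _         = refl
coeff-fromTop-above a (suc N) (suc i) (s≤s N<i) = coeff-fromTop-above a N i N<i

eval-fromTop-- : ∀ a b N x → eval (fromTop (λ r → a r - b r) N) x ≡ eval (fromTop a N) x - eval (fromTop b N) x
eval-fromTop-- a b zero    x = lem (a 0) (b 0) x
  where
  lem : ∀ p q x → (p - q) + x * 0ℚ ≡ (p + x * 0ℚ) - (q + x * 0ℚ)
  lem = solve 3 (λ p q x → (p :- q) :+ x :* con 0ℚ := (p :+ x :* con 0ℚ) :- (q :+ x :* con 0ℚ)) refl
eval-fromTop-- a b (suc N) x =
  trans (cong (λ y → (a (suc N) - b (suc N)) + x * y) (eval-fromTop-- a b N x))
        (lem (a (suc N)) (b (suc N)) x _ _)
  where
  lem : ∀ p q x y z → (p - q) + x * (y - z) ≡ (p + x * y) - (q + x * z)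
  lem = solve 5 (λ p q x y z → (p :- q) :+ x :* (y :- z) := (p :+ x :* y) :- (q :+ x :* z)) refl

-- This is the effect of s added isolated vertices: the new low-order coefficients are values of `a`
-- beyond N, which are zero.
eval-fromTop-pad : ∀ a N → (∀ r → N ℕ.< r → a r ≡ 0ℚ) → ∀ s x →
  x ^ℚ s * eval (fromTop a N) x ≡ eval (fromTop a (s ℕ.+ N)) x
eval-fromTop-pad a N h zero    x = ℚ.*-identityˡ _
eval-fromTop-pad a N h (suc s) x = begin
  (x * x ^ℚ s) * eval (fromTop a N) x
    ≡⟨ ℚ.*-assoc x (x ^ℚ s) _ ⟩
  x * (x ^ℚ s * eval (fromTop a N) x)
    ≡⟨ cong (x *_) (eval-fromTop-pad a N h s x) ⟩
  x * eval (fromTop a (s ℕ.+ N)) x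
    ≡⟨ ℚ.+-identityˡ _ ⟨
  0ℚ + x * eval (fromTop a (s ℕ.+ N)) x
    ≡⟨ cong (_+ x * eval (fromTop a (s ℕ.+ N)) x) (h (suc (s ℕ.+ N)) (s≤s (ℕ.m≤n+m N s))) ⟨
  a (suc (s ℕ.+ N)) + x * eval (fromTop a (s ℕ.+ N)) x ∎
  where open ≡-Reasoning

fromTop-unique : ∀ a b M → (∀ n → eval (fromTop a M) (fromℕ n) ≡ eval (fromTop b M) (fromℕ n)) →
                 ∀ r → r ℕ.≤ M → a r ≡ b r
fromTop-unique a b M h r r≤M = begin
  a r                ≡⟨ lem (a r) (b r) ⟩
  (a r - b r) + b r  ≡⟨ cong (_+ b r) (trans (sym (coeff-fromTop _ M r r≤M)) (zeros (M ℕ.∸ r))) ⟩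
  0ℚ + b r           ≡⟨ ℚ.+-identityˡ (b r) ⟩
  b r                ∎
  where
  open ≡-Reasoning
  lem : ∀ p q → p ≡ (p - q) + q
  lem = solve 2 (λ p q → p := (p :- q) :+ q) refl
  zeros : ∀ i → coeff (fromTop (λ r → a r - b r) M) i ≡ 0ℚ
  zeros = vanishing⇒zero _ (fromTop (λ r → a r - b r) M) refl 0 λ n →
    trans (eval-fromTop-- a b M (fromℕ n))
          (trans (cong (_- eval (fromTop b M) (fromℕ n)) (h n)) (ℚ.+-inverseʳ (eval (fromTop b M) (fromℕ n))))

-- The left graph is the right one together with N - s isolated vertices. This is invisible in the
-- recursion, so the numbers of colourings are compared: n^s times the left one is n^N times the
-- right one. Both sides are polynomials of degree s + N whose coefficients from the top are those
-- wanted.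
C-place : ∀ {N s} (R : Adj N) (v : Vec (Fin N) s) B → distinct v ≡ true → ∀ r →
          C r N (restrict R (place empty v B)) ≡ C r s (restrict (pull R v) B)
C-place {N} {s} R v B dv r with r ℕ.≤? s ℕ.+ N
... | no r≰ = trans (C-vanish r N _ (ℕ.≤-<-trans (ℕ.m≤n+m N s) (ℕ.≰⇒> r≰)))
                    (sym (C-vanish r s _ (ℕ.≤-<-trans (ℕ.m≤m+n s N) (ℕ.≰⇒> r≰))))
... | yes r≤ = fromTop-unique a b (s ℕ.+ N) agree r r≤
  where
  open ≡-Reasoning
  a b : ℕ → ℚ
  a r = C r N (restrict R (place empty v B))
  b r = C r s (restrict (pull R v) B)
  agree : ∀ n → eval (fromTop a (s ℕ.+ N)) (fromℕ n) ≡ eval (fromTop b (s ℕ.+ N)) (fromℕ n)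
  agree n = begin
    eval (fromTop a (s ℕ.+ N)) x
      ≡⟨ eval-fromTop-pad a N (λ r → C-vanish r N _) s x ⟨
    x ^ℚ s * eval (fromTop a N) x
      ≡⟨ cong (x ^ℚ s *_) (chromatic n N _) ⟨
    x ^ℚ s * colourings n N (restrict R (place empty v B))
      ≡⟨ cong (x ^ℚ s *_) (∑-cong (vec (fin n) N) (λ c → cong (_▷ 1ℚ) (proper-place R v B dv c))) ⟩
    x ^ℚ s * ∑ (vec (fin n) N) (λ c → does (proper? (restrict (pull R v) B) (Vec.map (lookup c) v)) ▷ 1ℚ)
      ≡⟨ ∑-pull n v dv (λ d → does (proper? (restrict (pull R v) B) d) ▷ 1ℚ) ⟩
    x ^ℚ N * colourings n s (restrict (pull R v) B)
      ≡⟨ cong (x ^ℚ N *_) (chromatic n s _) ⟩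
    x ^ℚ N * eval (fromTop b s) x
      ≡⟨ eval-fromTop-pad b s (λ r → C-vanish r s _) N x ⟩
    eval (fromTop b (N ℕ.+ s)) x
      ≡⟨ cong (λ M → eval (fromTop b M) x) (ℕ.+-comm N s) ⟩
    eval (fromTop b (s ℕ.+ N)) x ∎
    where
    x : ℚ
    x = fromℕ n

-- The coefficient as a sum over tuples of vertices, where each summand depends only on
-- which entries of the tuple are equal or adjacent.
local : ℕ → ∀ {N s} → Adj N → Vec (Fin N) s → ℚ
local r {s = s} R v = distinct v ▷ Δ s (λ B → C r s (restrict (pull R v) B))

C-local : ∀ r N (R : Adj N) →
  C r N R ≡ ∑ (fin (degreeBound r)) (λ s → T N (toℕ s) (λ S → C r N (restrict R S)))
C-local r N R = trans (C-ext r N (λ i j → sym (whole i j)))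
  (value-at-full (degreeBound r) N _ (C-degree r N R))
  where
  whole : ∀ i j → restrict R full i j ≡ R i j
  whole i j rewrite lookup-replicate i true | lookup-replicate j true with R i j
  ... | true  = refl
  ... | false = refl

T-local : ∀ r N s (R : Adj N) →
  fromℕ (s !) * T N s (λ S → C r N (restrict R S)) ≡ ∑ (vec (fin N) s) (local r R)
T-local r N s R = trans (sym (∑D-factorial N s _)) (∑-cong (vec (fin N) s) summand)
  where
  summand : ∀ v → D v (λ S → C r N (restrict R S)) empty ≡ local r R v
  summand v with distinct v in dv
  -- Repeated entries contribute zero, which is why `local` carries the guard `distinct v`.
  ... | false = D-repetition v _ dv empty
  ... | true  = trans (D-as-Δ v _ empty) (Δ-cong s (λ B → C-place R v B dv r))

-- Definable families and homomorphism numbers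

∑ᴸ : ∀ {A : Set} → List A → (A → ℚ) → ℚ
∑ᴸ xs F = ∑ (fin (length xs)) (λ i → F (List.lookup xs i))

length-filter : ∀ {A : Set} {P : A → Set} (P? : ∀ x → Dec (P x)) xs →
                fromℕ (length (filter P? xs)) ≡ ∑ᴸ xs (λ x → does (P? x) ▷ 1ℚ)
length-filter P? []       = refl
length-filter P? (x ∷ xs) with does (P? x)
... | true  = trans (fromℕ-suc (length (filter P? xs))) (cong (1ℚ +_) (length-filter P? xs))
... | false = trans (length-filter P? xs) (sym (ℚ.+-identityˡ _))

∑ᴸ-filter : ∀ {A : Set} {P : A → Set} (P? : ∀ x → Dec (P x)) xs F →
            ∑ᴸ (filter P? xs) F ≡ ∑ᴸ xs (λ x → does (P? x) ▷ F x)
∑ᴸ-filter P? []       F = refl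
∑ᴸ-filter P? (x ∷ xs) F with does (P? x)
... | true  = cong (F x +_) (∑ᴸ-filter P? xs F)
... | false = trans (∑ᴸ-filter P? xs F) (sym (ℚ.+-identityˡ _))

∑ᴸ-map : ∀ {A B : Set} (g : A → B) xs F → ∑ᴸ (List.map g xs) F ≡ ∑ᴸ xs (F ∘ g)
∑ᴸ-map g []       F = refl
∑ᴸ-map g (x ∷ xs) F = cong (F (g x) +_) (∑ᴸ-map g xs F)

∑ᴸ-tabulate : ∀ {A : Set} {n} (g : Fin n → A) F → ∑ᴸ (List.tabulate g) F ≡ ∑ (fin n) (F ∘ g)
∑ᴸ-tabulate {n = zero}  g F = refl
∑ᴸ-tabulate {n = suc n} g F = cong (F (g zero) +_) (∑ᴸ-tabulate (g ∘ suc) F)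

∑-++ : ∀ m n (F : Fin (m ℕ.+ n) → ℚ) →
       ∑ (fin (m ℕ.+ n)) F ≡ ∑ (fin m) (λ i → F (i ↑ˡ n)) + ∑ (fin n) (λ j → F (m ↑ʳ j))
∑-++ zero    n F = sym (ℚ.+-identityˡ _)
∑-++ (suc m) n F = trans (cong (F zero +_) (∑-++ m n (F ∘ suc))) (sym (ℚ.+-assoc (F zero) _ _))

∑-combine : ∀ m n (F : Fin (m ℕ.* n) → ℚ) →
            ∑ (fin (m ℕ.* n)) F ≡ ∑ (fin m) (λ i → ∑ (fin n) (λ j → F (combine i j)))
∑-combine zero    n F = refl
∑-combine (suc m) n F =
  trans (∑-++ n (m ℕ.* n) F) (cong (∑ (fin n) (λ j → F (j ↑ˡ (m ℕ.* n))) +_) (∑-combine m n (F ∘ (n ↑ʳ_))))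

-- The values of `finToFun` and of `lookup` can be matched only pointwise, so a summand must respect
-- pointwise equality.
Extensional : ∀ {m n} → ((Fin m → Fin n) → ℚ) → Set
Extensional F = ∀ f g → (∀ i → f i ≡ g i) → F f ≡ F g

∑-finToFun : ∀ m n (F : (Fin m → Fin n) → ℚ) → Extensional F →
             ∑ (fin (n ℕ.^ m)) (F ∘ finToFun) ≡ ∑ (vec (fin n) m) (F ∘ lookup)
∑-finToFun zero    n F ext = trans (ℚ.+-identityʳ _) (ext _ _ (λ ()))
∑-finToFun (suc m) n F ext = begin
  ∑ (fin (n ℕ.* n ℕ.^ m)) (F ∘ finToFun)
    ≡⟨ ∑-combine n (n ℕ.^ m) (F ∘ finToFun) ⟩
  ∑ (fin n) (λ x → ∑ (fin (n ℕ.^ m)) (λ j → F (finToFun (combine x j))))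
    ≡⟨ ∑-cong (fin n) (λ x → ∑-cong (fin (n ℕ.^ m)) (λ j → ext _ _ (split x j))) ⟩
  ∑ (fin n) (λ x → ∑ (fin (n ℕ.^ m)) (λ j → F (cons x (finToFun j))))
    ≡⟨ ∑-cong (fin n) (λ x → ∑-finToFun m n (F ∘ cons x)
         (λ f g e → ext _ _ λ { zero → refl ; (suc i) → e i })) ⟩
  ∑ (fin n) (λ x → ∑ (vec (fin n) m) (λ v → F (cons x (lookup v))))
    ≡⟨ ∑-cong (fin n) (λ x → ∑-cong (vec (fin n) m) (λ v → ext _ _ λ { zero → refl ; (suc i) → refl })) ⟩
  ∑ (fin n) (λ x → ∑ (vec (fin n) m) (λ v → F (lookup (x ∷ v)))) ∎
  where
  open ≡-Reasoning
  cons : Fin n → (Fin m → Fin n) → Fin (suc m) → Fin n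
  cons x f zero    = x
  cons x f (suc i) = f i
  split : ∀ x (j : Fin (n ℕ.^ m)) i → finToFun (combine x j) i ≡ cons x (finToFun j) i
  split x j zero    = cong proj₁ (remQuot-combine x j)
  split x j (suc i) = cong (λ p → finToFun (proj₂ p) i) (remQuot-combine x j)

∑ᴸ-functions : ∀ m n (F : (Fin m → Fin n) → ℚ) → Extensional F →
               ∑ᴸ (functions m n) F ≡ ∑ (vec (fin n) m) (F ∘ lookup)
∑ᴸ-functions m n F ext = begin
  ∑ᴸ (functions m n) F                      ≡⟨ ∑ᴸ-map finToFun (List.allFin (n ℕ.^ m)) F ⟩
  ∑ᴸ (List.allFin (n ℕ.^ m)) (F ∘ finToFun)  ≡⟨ ∑ᴸ-tabulate (λ i → i) (F ∘ finToFun) ⟩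
  ∑ (fin (n ℕ.^ m)) (F ∘ finToFun)           ≡⟨ ∑-finToFun m n F ext ⟩
  ∑ (vec (fin n) m) (F ∘ lookup)             ∎
  where open ≡-Reasoning

does-cong : ∀ {P Q : Set} (p? : Dec P) (q? : Dec Q) → (P → Q) → (Q → P) → does p? ≡ does q?
does-cong p? q? f g = ⇔⇒≡ (dec-true q? ∘ f ∘ does⇒ p?) (dec-true p? ∘ g ∘ does⇒ q?)

open Graph using (order)

hom-as-∑ : ∀ F G → fromℕ (hom F G) ≡ ∑ (vec (fin (order G)) (order F)) (λ w → does (isHom? F G (lookup w)) ▷ 1ℚ)
hom-as-∑ F G = trans (length-filter (isHom? F G) (functions (order F) (order G)))
  (∑ᴸ-functions (order F) (order G) _ λ f g e → cong (_▷ 1ℚ) (does-cong (isHom? F G f) (isHom? F G g)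
    (λ h u v uv → subst₂ (Graph._~_ G) (e u) (e v) (h u v uv))
    (λ h u v uv → subst₂ (Graph._~_ G) (sym (e u)) (sym (e v)) (h u v uv))))

-- Polynomial dependence on q and identification of variables

IsPoly : (ℕ → ℚ) → Set
IsPoly h = Σ[ p ∈ Poly ] ∀ q → h q ≡ eval p (fromℕ q)

IsPoly-ext : ∀ {h h′} → (∀ q → h q ≡ h′ q) → IsPoly h′ → IsPoly h
IsPoly-ext e (p , H) = p , λ q → trans (e q) (H q)

IsPoly-0 : IsPoly (λ _ → 0ℚ)
IsPoly-0 = [] , λ _ → refl

_⊞_ : Poly → Poly → Poly
[]      ⊞ r       = r
(a ∷ p) ⊞ []      = a ∷ p
(a ∷ p) ⊞ (b ∷ r) = (a + b) ∷ (p ⊞ r)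

eval-⊞ : ∀ p r x → eval (p ⊞ r) x ≡ eval p x + eval r x
eval-⊞ []      r       x = sym (ℚ.+-identityˡ _)
eval-⊞ (a ∷ p) []      x = sym (ℚ.+-identityʳ _)
eval-⊞ (a ∷ p) (b ∷ r) x = trans (cong (λ y → (a + b) + x * y) (eval-⊞ p r x)) (lem a b x (eval p x) (eval r x))
  where
  lem : ∀ a b x y z → (a + b) + x * (y + z) ≡ (a + x * y) + (b + x * z)
  lem = solve 5 (λ a b x y z → (a :+ b) :+ x :* (y :+ z) := (a :+ x :* y) :+ (b :+ x :* z)) refl

eval-scale : ∀ a p x → eval (List.map (a *_) p) x ≡ a * eval p x
eval-scale a []      x = sym (ℚ.*-zeroʳ a)
eval-scale a (b ∷ p) x = trans (cong (λ y → a * b + x * y) (eval-scale a p x)) (lem a b x (eval p x))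
  where
  lem : ∀ a b x y → a * b + x * (a * y) ≡ a * (b + x * y)
  lem = solve 4 (λ a b x y → a :* b :+ x :* (a :* y) := a :* (b :+ x :* y)) refl

IsPoly-+ : ∀ {h h′} → IsPoly h → IsPoly h′ → IsPoly (λ q → h q + h′ q)
IsPoly-+ (p , H) (p′ , H′) = p ⊞ p′ , λ q → trans (cong₂ _+_ (H q) (H′ q)) (sym (eval-⊞ p p′ (fromℕ q)))

IsPoly-* : ∀ a {h} → IsPoly h → IsPoly (λ q → a * h q)
IsPoly-* a (p , H) = List.map (a *_) p , λ q → trans (cong (a *_) (H q)) (sym (eval-scale a p (fromℕ q)))

IsPoly-∑ : ∀ c {h : El c → ℕ → ℚ} → (∀ x → IsPoly (h x)) → IsPoly (λ q → ∑ c (λ x → h x q))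
IsPoly-∑ (fin zero)      H = IsPoly-0
IsPoly-∑ (fin (suc n))   H = IsPoly-+ (H zero) (IsPoly-∑ (fin n) (H ∘ suc))
IsPoly-∑ (vec c zero)    H = H []
IsPoly-∑ (vec c (suc s)) H = IsPoly-∑ c (λ x → IsPoly-∑ (vec c s) (λ v → H (x ∷ v)))

∑-insertAt : ∀ c {t} (a : Fin (suc t)) (F : Vec (El c) (suc t) → ℚ) →
             ∑ (vec c (suc t)) F ≡ ∑ c (λ x → ∑ (vec c t) (λ w → F (insertAt w a x)))
∑-insertAt c         zero    F = refl
∑-insertAt c {suc t} (suc a) F =
  trans (∑-cong c (λ y → ∑-insertAt c a (λ w → F (y ∷ w)))) (∑-comm c c _)

-- The map from t + 1 variables onto t that gives `a` the variable of `b` and is the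
-- order-preserving bijection on the rest.
identification : ∀ {t} {a b : Fin (suc t)} → a ≢ b → Vec (Fin t) (suc t)
identification {t} {a} a≢b = insertAt (allFin t) a (punchOut a≢b)

∑-identify : ∀ n {t} {a b : Fin (suc t)} (a≢b : a ≢ b) (F : Vec (Fin n) (suc t) → ℚ) →
  ∑ (vec (fin n) (suc t)) (λ w → does (lookup w a Fin.≟ lookup w b) ▷ F w) ≡
  ∑ (vec (fin n) t) (λ w → F (Vec.map (lookup w) (identification a≢b)))
∑-identify n {t} {a} {b} a≢b F = begin
  ∑ (vec (fin n) (suc t)) (λ w → does (lookup w a Fin.≟ lookup w b) ▷ F w)
    ≡⟨ ∑-insertAt (fin n) a (λ w → does (lookup w a Fin.≟ lookup w b) ▷ F w) ⟩
  ∑ (fin n) (λ x → ∑ (vec (fin n) t) (λ w → does (lookup (insertAt w a x) a Fin.≟ lookup (insertAt w a x) b) ▷ F (insertAt w a x)))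
    ≡⟨ ∑-comm (fin n) (vec (fin n) t) _ ⟩
  ∑ (vec (fin n) t) (λ w → ∑ (fin n) (λ x → does (lookup (insertAt w a x) a Fin.≟ lookup (insertAt w a x) b) ▷ F (insertAt w a x)))
    ≡⟨ ∑-cong (vec (fin n) t) (λ w → ∑-cong (fin n) λ x → cong (_▷ F (insertAt w a x)) (equality w x)) ⟩
  ∑ (vec (fin n) t) (λ w → ∑ (fin n) (λ x → does (x Fin.≟ lookup w (punchOut a≢b)) ▷ F (insertAt w a x)))
    ≡⟨ ∑-cong (vec (fin n) t) (λ w → ∑-δ (lookup w (punchOut a≢b)) (λ x → F (insertAt w a x))) ⟩
  ∑ (vec (fin n) t) (λ w → F (insertAt w a (lookup w (punchOut a≢b))))
    ≡⟨ ∑-cong (vec (fin n) t) (λ w → cong F (trans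
         (cong (λ v → insertAt v a (lookup w (punchOut a≢b))) (sym (map-lookup-allFin w)))
         (sym (map-insertAt (lookup w) (punchOut a≢b) (allFin t) a)))) ⟩
  ∑ (vec (fin n) t) (λ w → F (Vec.map (lookup w) (identification a≢b))) ∎
  where
  open ≡-Reasoning
  equality : ∀ (w : Vec (Fin n) t) x →
    does (lookup (insertAt w a x) a Fin.≟ lookup (insertAt w a x) b) ≡ does (x Fin.≟ lookup w (punchOut a≢b))
  equality w x = cong₂ (λ y z → does (y Fin.≟ z)) (insertAt-lookup w a x)
    (trans (cong (lookup (insertAt w a x)) (sym (punchIn-punchOut a≢b))) (insertAt-punchIn w a x (punchOut a≢b)))

graphOf : ∀ {t} (R : List (Fin t × Fin t)) → ¬ Any (λ e → proj₁ e ≡ proj₂ e) R → Graph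
graphOf {t} R loopless = record
  { order  = t
  ; _~_    = λ u v → (u , v) ∈ R ⊎ (v , u) ∈ R
  ; _~?_   = λ u v → ((u , v) ∈? R) ⊎-dec ((v , u) ∈? R)
  ; symm   = swap
  ; irrefl = λ { refl (inj₁ e) → loopless (Any.map (λ { refl → refl }) e)
               ; refl (inj₂ e) → loopless (Any.map (λ { refl → refl }) e) }
  }
  where open DecMembership (≡-dec (Fin._≟_ {t}) (Fin._≟_ {t}))

adjᵇ : (Γ : Graph) → Adj (order Γ)
adjᵇ Γ i j = does (Graph._~?_ Γ i j)

joined : (Γ : Graph) (k : ℕ) → Fin (order Γ) × Fin k → Fin (order Γ) × Fin k → Bool
joined Γ k (i , a) (j , b) = adjᵇ Γ i j ∨ (does (i Fin.≟ j) ∧ not (does (a Fin.≟ b)))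

-- The lexicographic product of Γ with the complete graph on k vertices.
blowUp : (Γ : Graph) (k : ℕ) → Adj (order Γ ℕ.* k)
blowUp Γ k x y = joined Γ k (remQuot k x) (remQuot k y)

blowUp-combine : ∀ Γ k i j a b → blowUp Γ k (combine i a) (combine j b) ≡ joined Γ k (i , a) (j , b)
blowUp-combine Γ k i j a b = cong₂ (joined Γ k) (remQuot-combine i a) (remQuot-combine j b)

module Definability (G : ℕ → Graph) (polynomial : StronglyPolynomial G) where

  V : ℕ → ℕ
  V q = order (G q)

  adj : ∀ q → Adj (V q)
  adj q = adjᵇ (G q)

  -- For a loopless `R` the satisfying assignments are the homomorphisms into `G q` from the graph
  -- on the t variables with edge list `R`.
  sat : ∀ {t} → List (Fin t × Fin t) → ∀ q → Vec (Fin (V q)) t → Bool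
  sat []            q w = true
  sat ((i , j) ∷ R) q w = adj q (lookup w i) (lookup w j) ∧ sat R q w

  Family : ℕ → Set
  Family s = ∀ q → Vec (Fin (V q)) s → ℚ

  -- Quantifying over R and σ makes the class closed under multiplication by indicators of
  -- adjacency (enlarge R) and of equality (identify two of the t variables).
  record Definable {s} (φ : Family s) : Set where
    field
      isPoly : ∀ t (R : List (Fin t × Fin t)) (σ : Vec (Fin t) s) →
        IsPoly (λ q → ∑ (vec (fin (V q)) t) (λ w → sat R q w ▷ φ q (Vec.map (lookup w) σ)))

  open Definable

  sat-loop : ∀ {t} (R : List (Fin t × Fin t)) → Any (λ e → proj₁ e ≡ proj₂ e) R → ∀ q w → sat R q w ≡ false
  sat-loop ((i , i) ∷ R) (here refl) q w =
    cong (_∧ sat R q w) (dec-false (Graph._~?_ (G q) (lookup w i) (lookup w i)) (Graph.irrefl (G q) refl))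
  sat-loop ((i , j) ∷ R) (there l) q w with adj q (lookup w i) (lookup w j)
  ... | true  = sat-loop R l q w
  ... | false = refl

  sat-hom : ∀ {t} (R : List (Fin t × Fin t)) loopless q w →
            sat R q w ≡ does (isHom? (graphOf R loopless) (G q) (lookup w))
  sat-hom {t} R loopless q w = ⇔⇒≡
    (λ e → dec-true (isHom? F (G q) (lookup w)) λ { u v (inj₁ uv) → edge R e uv
                                                  ; u v (inj₂ vu) → Graph.symm (G q) (edge R e vu) })
    (λ e → all R (λ {u} {v} uv → does⇒ (isHom? F (G q) (lookup w)) e u v (inj₁ uv)))
    where
    F : Graph
    F = graphOf R loopless
    edge : ∀ R {u v} → sat R q w ≡ true → Any ((u , v) ≡_) R → Graph._~_ (G q) (lookup w u) (lookup w v)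
    edge ((i , j) ∷ R) e (here refl) = does⇒ (Graph._~?_ (G q) (lookup w i) (lookup w j)) (proj₁ (∧-true e))
    edge ((i , j) ∷ R) e (there uv)  = edge R (proj₂ (∧-true {adj q (lookup w i) (lookup w j)} e)) uv
    all : ∀ R → (∀ {u v} → Any ((u , v) ≡_) R → Graph._~_ (G q) (lookup w u) (lookup w v)) → sat R q w ≡ true
    all []            h = refl
    all ((i , j) ∷ R) h = cong₂ _∧_ (dec-true (Graph._~?_ (G q) (lookup w i) (lookup w j)) (h (here refl)))
                                    (all R (h ∘ there))

  -- Here strong polynomiality enters: the sums are homomorphism numbers of fixed graphs, or zero if
  -- `R` contains a loop.
  definable-1 : ∀ {s} → Definable {s} (λ _ _ → 1ℚ)
  definable-1 .isPoly t R σ with any? (λ e → proj₁ e Fin.≟ proj₂ e) R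
  ... | yes l = IsPoly-ext (λ q → trans (∑-cong (vec (fin (V q)) t) (λ w → cong (_▷ 1ℚ) (sat-loop R l q w)))
                                        (∑-0 (vec (fin (V q)) t))) IsPoly-0
  ... | no ¬l = IsPoly-ext (λ q → trans (∑-cong (vec (fin (V q)) t) (λ w → cong (_▷ 1ℚ) (sat-hom R ¬l q w)))
                                        (sym (hom-as-∑ (graphOf R ¬l) (G q)))) (polynomial (graphOf R ¬l))

  definable-ext : ∀ {s} {φ ψ : Family s} → (∀ q v → φ q v ≡ ψ q v) → Definable ψ → Definable φ
  definable-ext e d .isPoly t R σ =
    IsPoly-ext (λ q → ∑-cong (vec (fin (V q)) t) (λ w → cong (sat R q w ▷_) (e q _))) (isPoly d t R σ)

  definable-+ : ∀ {s} {φ ψ : Family s} → Definable φ → Definable ψ → Definable (λ q v → φ q v + ψ q v)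
  definable-+ d d′ .isPoly t R σ = IsPoly-ext
    (λ q → trans (∑-cong (vec (fin (V q)) t) (λ w → ▷-+ (sat R q w) _ _)) (∑-+ (vec (fin (V q)) t) _ _))
    (IsPoly-+ (isPoly d t R σ) (isPoly d′ t R σ))

  definable-* : ∀ {s} a {φ : Family s} → Definable φ → Definable (λ q v → a * φ q v)
  definable-* a d .isPoly t R σ = IsPoly-ext
    (λ q → trans (∑-cong (vec (fin (V q)) t) (λ w → ▷-scale (sat R q w) a _)) (∑-* (vec (fin (V q)) t) a _))
    (IsPoly-* a (isPoly d t R σ))

  definable-- : ∀ {s} {φ ψ : Family s} → Definable φ → Definable ψ → Definable (λ q v → φ q v - ψ q v)
  definable-- {φ = φ} {ψ} d d′ = definable-ext (λ q v → lem (φ q v) (ψ q v)) (definable-+ d (definable-* (- 1ℚ) d′))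
    where
    lem : ∀ x y → x - y ≡ x + (- 1ℚ) * y
    lem = solve 2 (λ x y → x :- y := x :+ con (- 1ℚ) :* y) refl

  definable-0 : ∀ {s} → Definable {s} (λ _ _ → 0ℚ)
  definable-0 = definable-ext (λ _ _ → refl) (definable-* 0ℚ definable-1)

  definable-∑ : ∀ n {s} {φ : Fin n → Family s} → (∀ i → Definable (φ i)) → Definable (λ q v → ∑ (fin n) (λ i → φ i q v))
  definable-∑ zero    d = definable-0
  definable-∑ (suc n) d = definable-+ (d zero) (definable-∑ n (d ∘ suc))

  definable-adj : ∀ {s} (i j : Fin s) {φ : Family s} → Definable φ →
                  Definable (λ q v → adj q (lookup v i) (lookup v j) ▷ φ q v)
  definable-adj i j {φ} d .isPoly t R σ = IsPoly-ext (λ q → ∑-cong (vec (fin (V q)) t) (λ w → step q w))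
    (isPoly d t ((lookup σ i , lookup σ j) ∷ R) σ)
    where
    step : ∀ q w → sat R q w ▷ adj q (lookup (Vec.map (lookup w) σ) i) (lookup (Vec.map (lookup w) σ) j) ▷ φ q (Vec.map (lookup w) σ)
         ≡ sat ((lookup σ i , lookup σ j) ∷ R) q w ▷ φ q (Vec.map (lookup w) σ)
    step q w rewrite lookup-map i (lookup w) σ | lookup-map j (lookup w) σ =
      trans (▷-comm (sat R q w) (adj q (lookup w (lookup σ i)) (lookup w (lookup σ j))) _)
            (sym (▷-∧ (adj q (lookup w (lookup σ i)) (lookup w (lookup σ j))) (sat R q w) _))

  sat-map : ∀ {t t′} (R : List (Fin t × Fin t)) (τ : Vec (Fin t′) t) q (w : Vec (Fin (V q)) t′) →
            sat R q (Vec.map (lookup w) τ) ≡ sat (List.map (λ e → lookup τ (proj₁ e) , lookup τ (proj₂ e)) R) q w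
  sat-map []            τ q w = refl
  sat-map ((i , j) ∷ R) τ q w =
    cong₂ _∧_ (cong₂ (adj q) (lookup-map i (lookup w) τ) (lookup-map j (lookup w) τ)) (sat-map R τ q w)

  definable-≟ : ∀ {s} (i j : Fin s) {φ : Family s} → Definable φ →
                Definable (λ q v → does (lookup v i Fin.≟ lookup v j) ▷ φ q v)
  definable-≟ {s} i j {φ} d .isPoly t R σ = IsPoly-ext
    (λ q → ∑-cong (vec (fin (V q)) t) λ w → cong (λ b → sat R q w ▷ b ▷ φ q (Vec.map (lookup w) σ))
      (cong₂ (λ x y → does (x Fin.≟ y)) (lookup-map i (lookup w) σ) (lookup-map j (lookup w) σ)))
    (identify t R σ (lookup σ i) (lookup σ j) (lookup σ i Fin.≟ lookup σ j))
    where
    identify : ∀ t (R : List (Fin t × Fin t)) (σ : Vec (Fin t) s) (a b : Fin t) → Dec (a ≡ b) → IsPoly (λ q →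
      ∑ (vec (fin (V q)) t) (λ w → sat R q w ▷ does (lookup w a Fin.≟ lookup w b) ▷ φ q (Vec.map (lookup w) σ)))
    identify t R σ a a (yes refl) = IsPoly-ext
      (λ q → ∑-cong (vec (fin (V q)) t) λ w → cong (λ b → sat R q w ▷ b ▷ φ q (Vec.map (lookup w) σ))
        (dec-true (lookup w a Fin.≟ lookup w a) refl))
      (isPoly d t R σ)
    -- The variable `a` is replaced by `b` in `R` and `σ`. If the two were joined, the new `R` has a
    -- loop, which is why the edge lists in `Definable` may contain loops.
    identify (suc t) R σ a b (no a≢b) = IsPoly-ext eliminate
      (isPoly d t (List.map (λ e → lookup τ (proj₁ e) , lookup τ (proj₂ e)) R) (Vec.map (lookup τ) σ))
      where
      τ : Vec (Fin t) (suc t)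
      τ = identification a≢b
      eliminate : ∀ q →
        ∑ (vec (fin (V q)) (suc t)) (λ w → sat R q w ▷ does (lookup w a Fin.≟ lookup w b) ▷ φ q (Vec.map (lookup w) σ)) ≡
        ∑ (vec (fin (V q)) t) (λ w → sat (List.map (λ e → lookup τ (proj₁ e) , lookup τ (proj₂ e)) R) q w ▷
          φ q (Vec.map (lookup w) (Vec.map (lookup τ) σ)))
      eliminate q = trans
        (trans (∑-cong (vec (fin (V q)) (suc t)) (λ w → ▷-comm (sat R q w) (does (lookup w a Fin.≟ lookup w b)) (φ q (Vec.map (lookup w) σ))))
               (∑-identify (V q) a≢b (λ w → sat R q w ▷ φ q (Vec.map (lookup w) σ))))
        (∑-cong (vec (fin (V q)) t) (λ w → cong₂ (λ b v → b ▷ φ q v) (sat-map R τ q w)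
          (trans (map-cong (λ i → lookup-map i (lookup w) τ) σ) (map-∘ (lookup w) (lookup τ) σ))))

  -- Quantifier-free formulas in the language of graphs. A syntax is needed so that the recursion
  -- for `C` can be run once, on formulas, for all q.
  data Formula (s : ℕ) : Set where
    const          : Bool → Formula s
    adjacent equal : Fin s → Fin s → Formula s
    ¬ᶠ_            : Formula s → Formula s
    _∧ᶠ_ _∨ᶠ_      : Formula s → Formula s → Formula s

  ⟦_⟧ : ∀ {s} → Formula s → ∀ q → Vec (Fin (V q)) s → Bool
  ⟦ const b ⟧      q v = b
  ⟦ adjacent i j ⟧ q v = adj q (lookup v i) (lookup v j)
  ⟦ equal i j ⟧    q v = does (lookup v i Fin.≟ lookup v j)
  ⟦ ¬ᶠ f ⟧         q v = not (⟦ f ⟧ q v)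
  ⟦ f ∧ᶠ g ⟧       q v = ⟦ f ⟧ q v ∧ ⟦ g ⟧ q v
  ⟦ f ∨ᶠ g ⟧       q v = ⟦ f ⟧ q v ∨ ⟦ g ⟧ q v

  -- By inclusion-exclusion, indicators of negations and disjunctions are linear combinations of
  -- indicators of conjunctions, which are handled one factor at a time.
  definable-▷ : ∀ {s} (f : Formula s) {φ : Family s} → Definable φ → Definable (λ q v → ⟦ f ⟧ q v ▷ φ q v)
  definable-▷ (const true)   d = d
  definable-▷ (const false)  d = definable-0
  definable-▷ (adjacent i j) d = definable-adj i j d
  definable-▷ (equal i j)    d = definable-≟ i j d
  definable-▷ (¬ᶠ f) {φ}     d = definable-ext (λ q v → lem (⟦ f ⟧ q v) (φ q v)) (definable-- d (definable-▷ f d))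
    where
    lem : ∀ b x → not b ▷ x ≡ x - (b ▷ x)
    lem true  x = sym (ℚ.+-inverseʳ x)
    lem false x = sym (ℚ.+-identityʳ x)
  definable-▷ (f ∧ᶠ g) {φ}   d =
    definable-ext (λ q v → ▷-∧ (⟦ f ⟧ q v) (⟦ g ⟧ q v) (φ q v)) (definable-▷ f (definable-▷ g d))
  definable-▷ (f ∨ᶠ g) {φ}   d = definable-ext (λ q v → lem (⟦ f ⟧ q v) (⟦ g ⟧ q v) (φ q v))
    (definable-- (definable-+ (definable-▷ f d) (definable-▷ g d)) (definable-▷ f (definable-▷ g d)))
    where
    lem : ∀ b c x → (b ∨ c) ▷ x ≡ ((b ▷ x) + (c ▷ x)) - (b ▷ c ▷ x)
    lem true  c x = cancel x (c ▷ x)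
      where
      cancel : ∀ x y → x ≡ (x + y) - y
      cancel = solve 2 (λ x y → x := (x :+ y) :- y) refl
    lem false c x = cancel (c ▷ x)
      where
      cancel : ∀ y → y ≡ (0ℚ + y) - 0ℚ
      cancel = solve 1 (λ y → y := (con 0ℚ :+ y) :- con 0ℚ) refl

  -- Here N is the length of a tuple and independent of q, so `C` unfolds to a fixed combination of
  -- indicators; the formulas mirror `nb` and `merge` and evaluate to them by computation.
  definable-C : ∀ {s} r N (R : Fin N → Fin N → Formula s) →
                Definable (λ q v → C r N (λ i j → ⟦ R i j ⟧ q v))
  definable-C     zero    N       R = definable-1
  definable-C     (suc r) zero    R = definable-0
  definable-C {s} (suc r) (suc N) R = definable--
    (definable-C (suc r) N (λ i j → R (suc i) (suc j)))
    (definable-∑ N λ u → definable-▷ (nbᶠ u) (definable-C r N λ i j →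
      R (suc i) (suc j) ∨ᶠ (const (does (i Fin.≟ u)) ∧ᶠ (const (does (u <? j)) ∧ᶠ nbᶠ j))))
    where
    nbᶠ : Fin N → Formula s
    nbᶠ u = R zero (suc u) ∨ᶠ R (suc u) zero

  definable-Δ : ∀ n {s} {g : ∀ q → Vec (Fin (V q)) s → SetFn n} →
                (∀ B → Definable (λ q v → g q v B)) → Definable (λ q v → Δ n (g q v))
  definable-Δ zero            d = d []
  definable-Δ (suc n) {g = g} d =
    definable-Δ n {g = λ q v → ∂₀ (g q v)} (λ B → definable-- (d (true ∷ B)) (d (false ∷ B)))

  definable⇒IsPoly : ∀ {s} {φ : Family s} → Definable φ → IsPoly (λ q → ∑ (vec (fin (V q)) s) (φ q))
  definable⇒IsPoly {s} {φ} d = IsPoly-ext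
    (λ q → ∑-cong (vec (fin (V q)) s) (λ w → cong (φ q) (sym (map-lookup-allFin w))))
    (isPoly d s [] (allFin s))

  module BlowUp (k : ℕ) where

    -- The second components range over k^s choices independent of q. With these fixed, what remains
    -- is a sum over tuples of vertices of `G q`.
    ∑-zipWith-combine : ∀ m s (F : Vec (Fin (m ℕ.* k)) s → ℚ) →
      ∑ (vec (fin (m ℕ.* k)) s) F ≡ ∑ (vec (fin k) s) (λ a → ∑ (vec (fin m) s) (λ w → F (zipWith combine w a)))
    ∑-zipWith-combine m zero    F = refl
    ∑-zipWith-combine m (suc s) F = begin
      ∑ (fin (m ℕ.* k)) (λ x → ∑ (vec (fin (m ℕ.* k)) s) (λ v → F (x ∷ v)))
        ≡⟨ ∑-combine m k _ ⟩
      ∑ (fin m) (λ i → ∑ (fin k) (λ a → ∑ (vec (fin (m ℕ.* k)) s) (λ v → F (combine i a ∷ v))))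
        ≡⟨ ∑-comm (fin m) (fin k) _ ⟩
      ∑ (fin k) (λ a → ∑ (fin m) (λ i → ∑ (vec (fin (m ℕ.* k)) s) (λ v → F (combine i a ∷ v))))
        ≡⟨ ∑-cong (fin k) (λ a → trans (∑-cong (fin m) (λ i → ∑-zipWith-combine m s (λ v → F (combine i a ∷ v))))
                                       (∑-comm (fin m) (vec (fin k) s) _)) ⟩
      ∑ (fin k) (λ a → ∑ (vec (fin k) s) (λ as → ∑ (fin m) (λ i → ∑ (vec (fin m) s) (λ w →
        F (combine i a ∷ zipWith combine w as))))) ∎
      where open ≡-Reasoning

    memberᶠ : ∀ {s s′} → Fin s → Fin k → Vec (Fin s) s′ → Vec (Fin k) s′ → Formula s
    memberᶠ i a []      []       = const false
    memberᶠ i a (j ∷ p) (b ∷ as) = (equal i j ∧ᶠ const (does (a Fin.≟ b))) ∨ᶠ memberᶠ i a p as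

    distinctᶠ : ∀ {s s′} → Vec (Fin s) s′ → Vec (Fin k) s′ → Formula s
    distinctᶠ []      []       = const true
    distinctᶠ (i ∷ p) (a ∷ as) = (¬ᶠ memberᶠ i a p as) ∧ᶠ distinctᶠ p as

    ⟦memberᶠ⟧ : ∀ {s s′} (i : Fin s) a (p : Vec (Fin s) s′) as q w →
      (combine (lookup w i) a ∈ᵇ zipWith combine (Vec.map (lookup w) p) as) ≡ ⟦ memberᶠ i a p as ⟧ q w
    ⟦memberᶠ⟧ i a []      []       q w = refl
    ⟦memberᶠ⟧ i a (j ∷ p) (b ∷ as) q w = cong₂ _∨_
      (does-cong (combine (lookup w i) a Fin.≟ combine (lookup w j) b)
                 ((lookup w i Fin.≟ lookup w j) ×-dec (a Fin.≟ b))
                 (Fin.combine-injective (lookup w i) a (lookup w j) b)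
                 (λ e → cong₂ combine (proj₁ e) (proj₂ e)))
      (⟦memberᶠ⟧ i a p as q w)

    ⟦distinctᶠ⟧ : ∀ {s s′} (p : Vec (Fin s) s′) as q w →
      distinct (zipWith combine (Vec.map (lookup w) p) as) ≡ ⟦ distinctᶠ p as ⟧ q w
    ⟦distinctᶠ⟧ []      []       q w = refl
    ⟦distinctᶠ⟧ (i ∷ p) (a ∷ as) q w = cong₂ (λ b c → not b ∧ c) (⟦memberᶠ⟧ i a p as q w) (⟦distinctᶠ⟧ p as q w)

    definable-local : ∀ r {s} (as : Vec (Fin k) s) →
      Definable (λ q w → local r (blowUp (G q) k) (zipWith combine w as))
    definable-local r {s} as = definable-ext rewritten
      (definable-▷ (distinctᶠ (allFin s) as)
        (definable-Δ s {g = λ q w B → C r s (λ x y → ⟦ pullᶠ B x y ⟧ q w)} λ B → definable-C r s (pullᶠ B)))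
      where
      pullᶠ : Vec Bool s → Fin s → Fin s → Formula s
      pullᶠ B x y = (adjacent x y ∨ᶠ (equal x y ∧ᶠ const (not (does (lookup as x Fin.≟ lookup as y)))))
                    ∧ᶠ const (lookup B x ∧ lookup B y)
      rewritten : ∀ q w → local r (blowUp (G q) k) (zipWith combine w as) ≡
        ⟦ distinctᶠ (allFin s) as ⟧ q w ▷ Δ s (λ B → C r s (λ x y → ⟦ pullᶠ B x y ⟧ q w))
      rewritten q w = cong₂ _▷_
        (trans (cong (λ v → distinct (zipWith combine v as)) (sym (map-lookup-allFin w))) (⟦distinctᶠ⟧ (allFin s) as q w))
        (Δ-cong s λ B → C-ext r s λ x y → cong (_∧ (lookup B x ∧ lookup B y))
          (trans (cong₂ (blowUp (G q) k) (lookup-zipWith combine x w as) (lookup-zipWith combine y w as))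
                 (blowUp-combine (G q) k (lookup w x) (lookup w y) (lookup as x) (lookup as y))))

    factorial≢0 : ∀ s → fromℕ (s !) ≢ 0ℚ
    factorial≢0 s e = ℕ.≢-nonZero⁻¹ (s !) {{ℕ._!≢0 s}} (fromℕ-injective e)

    C-IsPoly : ∀ r → IsPoly (λ q → C r (V q ℕ.* k) (blowUp (G q) k))
    C-IsPoly r = IsPoly-ext (λ q → C-local r (V q ℕ.* k) (blowUp (G q) k))
      (IsPoly-∑ (fin (degreeBound r)) (λ s → T-IsPoly (toℕ s)))
      where
      T-IsPoly : ∀ s → IsPoly (λ q → T (V q ℕ.* k) s (λ S → C r (V q ℕ.* k) (restrict (blowUp (G q) k) S)))
      -- `T-local` yields s! times the wanted sum of coefficients.
      T-IsPoly s = IsPoly-ext normalise (IsPoly-* (1/ fromℕ (s !))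
        (IsPoly-ext (λ q → trans (T-local r (V q ℕ.* k) s (blowUp (G q) k)) (∑-zipWith-combine (V q) s _))
          (IsPoly-∑ (vec (fin k) s) (λ as → definable⇒IsPoly (definable-local r as)))))
        where
        instance
          factorial-nonZero = ≢-nonZero (factorial≢0 s)
        normalise : ∀ q → T (V q ℕ.* k) s (λ S → C r (V q ℕ.* k) (restrict (blowUp (G q) k) S)) ≡
                    1/ fromℕ (s !) * (fromℕ (s !) * T (V q ℕ.* k) s (λ S → C r (V q ℕ.* k) (restrict (blowUp (G q) k) S)))
        normalise q = lem (T (V q ℕ.* k) s _)
          where
          lem : ∀ t → t ≡ 1/ fromℕ (s !) * (fromℕ (s !) * t)
          lem t = sym (trans (sym (ℚ.*-assoc (1/ fromℕ (s !)) (fromℕ (s !)) t))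
            (trans (cong (_* t) (ℚ.*-inverseˡ (fromℕ (s !)))) (ℚ.*-identityˡ t)))

-- Homomorphisms to KnBar

∑-vec-++ : ∀ c m n (F : Vec (El c) (m ℕ.+ n) → ℚ) →
  ∑ (vec c (m ℕ.+ n)) F ≡ ∑ (vec c m) (λ u → ∑ (vec c n) (λ v → F (u ++ v)))
∑-vec-++ c zero    n F = refl
∑-vec-++ c (suc m) n F = ∑-cong c (λ x → ∑-vec-++ c m n (λ v → F (x ∷ v)))

∑-concat : ∀ c m k (F : Vec (El c) (m ℕ.* k) → ℚ) → ∑ (vec c (m ℕ.* k)) F ≡ ∑ (vec (vec c k) m) (F ∘ concat)
∑-concat c zero    k F = refl
∑-concat c (suc m) k F = trans (∑-vec-++ c k (m ℕ.* k) F)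
  (∑-cong (vec c k) (λ u → ∑-concat c m k (λ v → F (u ++ v))))

Extensional₂ : ∀ {m k n} → ((Fin m → Fin k → Fin n) → ℚ) → Set
Extensional₂ P = ∀ f g → (∀ i a → f i a ≡ g i a) → P f ≡ P g

allInjective : ∀ {n k m} → Vec (Vec (Fin n) k) m → Bool
allInjective []      = true
allInjective (u ∷ W) = does (injective? (lookup u)) ∧ allInjective W

allInjective⇒ : ∀ {n k m} (W : Vec (Vec (Fin n) k) m) → allInjective W ≡ true →
                ∀ i → Injective _≡_ _≡_ (lookup (lookup W i))
allInjective⇒ (u ∷ W) e zero    = does⇒ (injective? (lookup u)) (proj₁ (∧-true e))
allInjective⇒ (u ∷ W) e (suc i) = allInjective⇒ W (proj₂ (∧-true {does (injective? (lookup u))} e)) i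

⇒allInjective : ∀ {n k m} (W : Vec (Vec (Fin n) k) m) →
                (∀ i → Injective _≡_ _≡_ (lookup (lookup W i))) → allInjective W ≡ true
⇒allInjective []      h = refl
⇒allInjective (u ∷ W) h = cong₂ _∧_ (dec-true (injective? (lookup u)) (h zero)) (⇒allInjective W (h ∘ suc))

-- Vertices of `KnBar n k` are positions in a list; passing to the listed injections turns vertex
-- maps into vectors that can be concatenated to colourings.
∑-tuples : ∀ n k m (P : (Fin m → Fin k → Fin n) → ℚ) → Extensional₂ P →
  ∑ (vec (fin (length (tuples n k))) m) (λ w → P (λ i → List.lookup (tuples n k) (lookup w i))) ≡
  ∑ (vec (vec (fin n) k) m) (λ W → allInjective W ▷ P (λ i → lookup (lookup W i)))
∑-tuples n k zero    P ext = ext _ _ (λ ())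
∑-tuples n k (suc m) P ext = begin
  ∑ (fin (length (tuples n k))) (λ x → ∑ ws (λ w → P (λ i → List.lookup (tuples n k) (lookup (x ∷ w) i))))
    ≡⟨ ∑-cong (fin (length (tuples n k))) (λ x → ∑-cong ws (λ w → ext _ _ λ { zero a → refl ; (suc i) a → refl })) ⟩
  ∑ᴸ (tuples n k) H
    ≡⟨ ∑ᴸ-filter injective? (functions k n) H ⟩
  ∑ᴸ (functions k n) (λ t → does (injective? t) ▷ H t)
    ≡⟨ ∑ᴸ-functions k n (λ t → does (injective? t) ▷ H t) (λ f g e → cong₂ _▷_
         (does-cong (injective? f) (injective? g)
           (λ inj {a} {b} eq → inj (trans (e a) (trans eq (sym (e b)))))
           (λ inj {a} {b} eq → inj (trans (sym (e a)) (trans eq (e b)))))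
         (∑-cong ws (λ w → ext (cons f (chosen w)) (cons g (chosen w)) λ { zero a → e a ; (suc i) a → refl }))) ⟩
  ∑ (vec (fin n) k) (λ u → does (injective? (lookup u)) ▷ H (lookup u))
    ≡⟨ ∑-cong (vec (fin n) k) (λ u → trans
         (cong (does (injective? (lookup u)) ▷_)
           (∑-tuples n k m (P ∘ cons (lookup u)) (λ f g e → ext _ _ λ { zero a → refl ; (suc i) a → e i a })))
         (trans (sym (∑-▷ Ws (does (injective? (lookup u))) _))
           (∑-cong Ws (λ W → trans (sym (▷-∧ (does (injective? (lookup u))) (allInjective W) _))
             (cong (allInjective (u ∷ W) ▷_) (ext _ _ λ { zero a → refl ; (suc i) a → refl })))))) ⟩
  ∑ (vec (fin n) k) (λ u → ∑ Ws (λ W → allInjective (u ∷ W) ▷ P (λ i → lookup (lookup (u ∷ W) i)))) ∎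
  where
  open ≡-Reasoning
  ws Ws : Code
  ws = vec (fin (length (tuples n k))) m
  Ws = vec (vec (fin n) k) m
  cons : (Fin k → Fin n) → (Fin m → Fin k → Fin n) → Fin (suc m) → Fin k → Fin n
  cons t f zero    = t
  cons t f (suc i) = f i
  chosen : Vec (Fin (length (tuples n k))) m → Fin m → Fin k → Fin n
  chosen w i = List.lookup (tuples n k) (lookup w i)
  H : (Fin k → Fin n) → ℚ
  H t = ∑ ws (λ w → P (cons t (chosen w)))

DisjointOnEdges : ∀ {n k} (Γ : Graph) → (Fin (order Γ) → Fin k → Fin n) → Set
DisjointOnEdges Γ f = ∀ u v → Graph._~_ Γ u v → DisjointTuples (f u) (f v)

disjointOnEdges? : ∀ {n k} Γ (f : Fin (order Γ) → Fin k → Fin n) → Dec (DisjointOnEdges Γ f)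
disjointOnEdges? Γ f = all? λ u → all? λ v → Graph._~?_ Γ u v →-dec disjointTuples? (f u) (f v)

-- A k-tuple colours the k copies of a vertex. Injectivity is properness inside the clique of
-- copies, and disjointness is properness between the copies of adjacent vertices.
proper-concat : ∀ {n} (Γ : Graph) k (W : Vec (Vec (Fin n) k) (order Γ)) →
  allInjective W ∧ does (disjointOnEdges? Γ (λ i → lookup (lookup W i))) ≡ does (proper? (blowUp Γ k) (concat W))
proper-concat {n} Γ k W = ⇔⇒≡ to from
  where
  f : Fin (order Γ) → Fin k → Fin n
  f i = lookup (lookup W i)
  to : allInjective W ∧ does (disjointOnEdges? Γ f) ≡ true → does (proper? (blowUp Γ k) (concat W)) ≡ true
  to e = dec-true (proper? (blowUp Γ k) (concat W)) λ x y x≢y r →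
    subst₂ (λ x y → lookup (concat W) x ≢ lookup (concat W) y) (combine-remQuot {order Γ} k x) (combine-remQuot {order Γ} k y)
      (λ eq → separated (remQuot k x) (remQuot k y) r
        (trans (sym (lookup-concat W _ _)) (trans eq (lookup-concat W _ _))))
    where
    separated : ∀ x y → joined Γ k x y ≡ true → f (proj₁ x) (proj₂ x) ≢ f (proj₁ y) (proj₂ y)
    separated (i , a) (j , b) r with ∨-true r
    ... | inj₁ ij = does⇒ (disjointOnEdges? Γ f) (proj₂ (∧-true {allInjective W} e)) i j
                          (does⇒ (Graph._~?_ Γ i j) ij) a b
    ... | inj₂ r′ with i≡j , a≢b ← ∧-true {does (i Fin.≟ j)} r′ with i Fin.≟ j | a Fin.≟ b
    ...   | yes refl | no ¬a≡b = ¬a≡b ∘ allInjective⇒ W (proj₁ (∧-true e)) i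
  from : does (proper? (blowUp Γ k) (concat W)) ≡ true → allInjective W ∧ does (disjointOnEdges? Γ f) ≡ true
  from e = cong₂ _∧_
    (⇒allInjective W λ i {a} {b} eq → decidable-stable (a Fin.≟ b) λ a≢b →
      apart i i a b (a≢b ∘ Fin.combine-injectiveʳ i a i b)
        (∨-introʳ (cong₂ _∧_ (dec-true (i Fin.≟ i) refl) (cong not (¬⇒false (a Fin.≟ b) a≢b)))) eq)
    (dec-true (disjointOnEdges? Γ f) λ u v uv a b →
      apart u v a b (λ eq → Graph.irrefl Γ (Fin.combine-injectiveˡ u a v b eq) uv)
        (∨-introˡ (dec-true (Graph._~?_ Γ u v) uv)))
    where
    ¬⇒false : ∀ {A : Set} (a? : Dec A) → ¬ A → does a? ≡ false
    ¬⇒false (yes a) ¬a = ⊥-elim (¬a a)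
    ¬⇒false (no _)  ¬a = refl
    apart : ∀ i j a b → combine i a ≢ combine j b → joined Γ k (i , a) (j , b) ≡ true → f i a ≢ f j b
    apart i j a b x≢y r eq = does⇒ (proper? (blowUp Γ k) (concat W)) e (combine i a) (combine j b) x≢y
      (trans (blowUp-combine Γ k i j a b) r)
      (trans (lookup-concat W i a) (trans eq (sym (lookup-concat W j b))))

hom-KnBar : ∀ (Γ : Graph) n k .{{_ : NonZero k}} →
            fromℕ (hom Γ (KnBar n k)) ≡ colourings n (order Γ ℕ.* k) (blowUp Γ k)
hom-KnBar Γ n k = begin
  fromℕ (hom Γ (KnBar n k))
    ≡⟨ hom-as-∑ Γ (KnBar n k) ⟩
  ∑ (vec (fin (length (tuples n k))) (order Γ)) (λ w → P (λ i → List.lookup (tuples n k) (lookup w i)))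
    ≡⟨ ∑-tuples n k (order Γ) P P-ext ⟩
  ∑ (vec (vec (fin n) k) (order Γ)) (λ W → allInjective W ▷ P (λ i → lookup (lookup W i)))
    ≡⟨ ∑-cong (vec (vec (fin n) k) (order Γ)) (λ W →
         trans (sym (▷-∧ (allInjective W) _ 1ℚ)) (cong (_▷ 1ℚ) (proper-concat Γ k W))) ⟩
  ∑ (vec (vec (fin n) k) (order Γ)) (λ W → does (proper? (blowUp Γ k) (concat W)) ▷ 1ℚ)
    ≡⟨ ∑-concat (fin n) (order Γ) k _ ⟨
  colourings n (order Γ ℕ.* k) (blowUp Γ k) ∎
  where
  open ≡-Reasoning
  P : (Fin (order Γ) → Fin k → Fin n) → ℚ
  P f = does (disjointOnEdges? Γ f) ▷ 1ℚ
  P-ext : Extensional₂ P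
  P-ext f g e = cong (_▷ 1ℚ) (does-cong (disjointOnEdges? Γ f) (disjointOnEdges? Γ g)
    (λ h u v uv a b eq → h u v uv a b (trans (e u a) (trans eq (sym (e v b)))))
    (λ h u v uv a b eq → h u v uv a b (trans (sym (e u a)) (trans eq (e v b)))))

-- Integrality of the degree function

IsInteger : ℚ → Set
IsInteger x = ∃[ w ] x ≡ fromℤ w

integer-+ : ∀ {x y} → IsInteger x → IsInteger y → IsInteger (x + y)
integer-+ (a , refl) (b , refl) = a ℤ.+ b , sym (fromℤ-+ a b)

integer-* : ∀ {x y} → IsInteger x → IsInteger y → IsInteger (x * y)
integer-* (a , refl) (b , refl) = a ℤ.* b , sym (fromℤ-* a b)

integer-ext : ∀ {x y} → x ≡ y → IsInteger y → IsInteger x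
integer-ext refl i = i

clear-denominator : ∀ x → fromℕ (↧ₙ x) * x ≡ fromℤ (↥ x)
clear-denominator x@(mkℚ n d-1 _) = ℚ.toℚᵘ-injective (begin
  toℚᵘ (fromℕ (suc d-1) * x)
    ≈⟨ ℚ.toℚᵘ-homo-* (fromℕ (suc d-1)) x ⟩
  toℚᵘ (fromℕ (suc d-1)) ℚᵘ.* toℚᵘ x
    ≈⟨ ℚᵘ.*-cong (ℚ.toℚᵘ-fromℚᵘ (ℚᵘ.mkℚᵘ (ℤ.+ suc d-1) 0)) (ℚᵘ.≃-refl {toℚᵘ x}) ⟩
  ℚᵘ.mkℚᵘ (ℤ.+ suc d-1) 0 ℚᵘ.* toℚᵘ x
    ≈⟨ ℚᵘ.*≡* (trans (ℤ.*-identityʳ _) (trans (ℤ.*-comm (ℤ.+ suc d-1) n)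
         (cong (λ m → n ℤ.* ℤ.+ m) (sym (ℕ.*-identityˡ (suc d-1)))))) ⟩
  ℚᵘ.mkℚᵘ n 0
    ≈⟨ ℚ.toℚᵘ-fromℚᵘ (ℚᵘ.mkℚᵘ n 0) ⟨
  toℚᵘ (fromℤ n) ∎)
  where open ℚᵘ.≃-Reasoning

Clears : ℕ → Poly → Set
Clears d p = All (λ a → IsInteger (fromℕ d * a)) p

clears-* : ∀ c {d p} → Clears d p → Clears (c ℕ.* d) p
clears-* c {d} = All.map (λ {a} i → integer-ext
  (trans (cong (_* a) (fromℕ-* c d)) (ℚ.*-assoc (fromℕ c) (fromℕ d) a)) (integer-* (ℤ.+ c , refl) i))

common-denominator : ∀ p → ∃[ d ] Clears (suc d) p
common-denominator []      = 0 , []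
common-denominator (a@(mkℚ n c _) ∷ p) with d , cl ← common-denominator p =
  -- The successor of this number is `suc c ℕ.* suc d`, the product of the denominators.
  d ℕ.+ c ℕ.* suc d ,
  integer-ext (trans (cong (λ m → fromℕ m * a) (ℕ.*-comm (suc c) (suc d)))
                (trans (cong (_* a) (fromℕ-* (suc d) (suc c))) (trans (ℚ.*-assoc (fromℕ (suc d)) (fromℕ (suc c)) a)
                  (cong (fromℕ (suc d) *_) (clear-denominator a)))))
              (integer-* (ℤ.+ suc d , refl) (n , refl))
  ∷ clears-* (suc c) {suc d} cl

cleared-eval : ∀ d p {x} → Clears d p → IsInteger x → IsInteger (fromℕ d * eval p x)
cleared-eval d []          []       i = integer-ext (ℚ.*-zeroʳ (fromℕ d)) (ℤ.+ 0 , refl)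
cleared-eval d (a ∷ p) {x} (c ∷ cl) i = integer-ext (lem (fromℕ d) a x (eval p x))
  (integer-+ c (integer-* i (cleared-eval d p cl i)))
  where
  lem : ∀ d a x y → d * (a + x * y) ≡ d * a + x * (d * y)
  lem = solve 4 (λ d a x y → d :* (a :+ x :* y) := d :* a :+ x :* (d :* y)) refl

-- With y and z the values of the tail at x and x + d m, a Horner step gives x (y - z) - m (d z),
-- and d z is an integer because d clears the coefficients.
cleared-shift : ∀ d p {x m} → Clears d p → IsInteger x → IsInteger m →
                IsInteger (eval p x - eval p (x + fromℕ d * m))
cleared-shift d []              []       i j = ℤ.+ 0 , refl
cleared-shift d (a ∷ p) {x} {m} (c ∷ cl) i j = integer-ext
  (lem a x (fromℕ d) m (eval p x) (eval p (x + fromℕ d * m)))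
  (integer-+ (integer-* i (cleared-shift d p cl i j))
    (integer-* (integer-* (ℤ.-[1+ 0 ] , refl) j)
      (cleared-eval d p cl (integer-+ i (integer-* (ℤ.+ d , refl) j)))))
  where
  lem : ∀ a x d m y z → (a + x * y) - (a + (x + d * m) * z) ≡ x * (y - z) + ((- 1ℚ) * m) * (d * z)
  lem = solve 6 (λ a x d m y z → (a :+ x :* y) :- (a :+ (x :+ d :* m) :* z) := x :* (y :- z) :+ (con (- 1ℚ) :* m) :* (d :* z)) refl

-- Modulo a common denominator D of the coefficients, every integer is congruent to a natural
-- number, and shifting the argument by a multiple of D changes the value by an integer.
natural-values⇒numerical : ∀ g (h : ℕ → ℕ) → (∀ q → fromℕ (h q) ≡ eval g (fromℕ q)) → IsNumerical g
natural-values⇒numerical g h H (ℤ.+ q)    = ℤ.+ h q , sym (H q)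
natural-values⇒numerical g h H -[1+ n ] with d , cl ← common-denominator g =
  integer-ext (lem (eval g x) (eval g y))
    (integer-+ (cleared-shift (suc d) g cl (-[1+ n ] , refl) (ℤ.+ suc n , refl))
      (integer-ext (cong (eval g) shifted) (ℤ.+ h (d ℕ.* suc n) , sym (H (d ℕ.* suc n)))))
  where
  x y : ℚ
  x = fromℤ -[1+ n ]
  -- The multiple is chosen so that -(n + 1) moves to the natural number d (n + 1).
  y = x + fromℕ (suc d) * fromℕ (suc n)
  lem : ∀ a b → a ≡ (a - b) + b
  lem = solve 2 (λ a b → a := (a :- b) :+ b) refl
  shifted : y ≡ fromℕ (d ℕ.* suc n)
  shifted = begin
    x + fromℕ (suc d) * fromℕ (suc n)
      ≡⟨ cong (x +_) (fromℕ-* (suc d) (suc n)) ⟨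
    x + fromℕ (suc n ℕ.+ d ℕ.* suc n)
      ≡⟨ cong (x +_) (fromℕ-+ (suc n) (d ℕ.* suc n)) ⟩
    x + (fromℕ (suc n) + fromℕ (d ℕ.* suc n))
      ≡⟨ ℚ.+-assoc x _ _ ⟨
    (x + fromℕ (suc n)) + fromℕ (d ℕ.* suc n)
      ≡⟨ cong (_+ fromℕ (d ℕ.* suc n)) (trans (sym (fromℤ-+ -[1+ n ] (ℤ.+ suc n))) (cong fromℤ (ℤ.n⊖n≡0 (suc n)))) ⟩
    0ℚ + fromℕ (d ℕ.* suc n)
      ≡⟨ ℚ.+-identityˡ _ ⟩
    fromℕ (d ℕ.* suc n) ∎
    where open ≡-Reasoning

-- The two-level structure

0≤fromℕ : ∀ n → 0ℚ ≤ fromℕ n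
0≤fromℕ n = ℚ.nonNegative⁻¹ (fromℕ n) {{ℚ.normalize-nonNeg n 1}}

-- Beyond the degree both sides are zero, so the agreement holds for all r; this makes the depth
-- infinite.
codegCoeff-fromTop : ∀ a N → (∀ r → N ℕ.< r → a r ≡ 0ℚ) → ∀ r → codegCoeff (fromTop a N) N r ≡ a r
codegCoeff-fromTop a N h r with r ℕ.≤ᵇ N in eq
... | true  = coeff-fromTop a N r (ℕ.≤ᵇ⇒≤ r N (subst IsTrue (sym eq) tt))
... | false = sym (h r (ℕ.≰⇒> (λ r≤N → subst IsTrue eq (ℕ.≤⇒≤ᵇ r≤N))))

theorem3p12 : (k : ℕ) .{{_ : NonZero k}} → IsTwoLevelTarget (λ n → KnBar n k)
theorem3p12 k G polynomial = g , (λ _ → ∞) , f , isTwoLevel , (λ _ _ → refl) , value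
  where
  open Definability G polynomial
  open BlowUp k
  N : ℕ → ℕ
  N q = V q ℕ.* k
  degree : IsPoly (λ q → fromℕ (N q))
  degree = IsPoly-ext
    (λ q → trans (fromℕ-* (V q) k) (trans (ℚ.*-comm (fromℕ (V q)) (fromℕ k))
      (cong (fromℕ k *_) (sym (trans (∑-const (V q) 1ℚ) (ℚ.*-identityʳ (fromℕ (V q))))))))
    -- The order of `G q` is the number of homomorphisms from the one-vertex graph.
    (IsPoly-* (fromℕ k) (definable⇒IsPoly {1} definable-1))
  g : Poly
  g = proj₁ degree
  c : ℕ → ℕ → ℚ
  c q r = C r (N q) (blowUp (G q) k)
  f : ℕ → Poly
  f q = fromTop (c q) (N q)
  -- As `g` takes the value `N q` at q, the set S is all of ℕ.
  nonneg : ∀ q → NonnegAt g q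
  nonneg q = subst (0ℚ ≤_) (proj₂ degree q) (0≤fromℕ (N q))
  value : ∀ q n → fromℕ (hom (G q) (KnBar n k)) ≡ eval (f q) (fromℕ n)
  value q n = trans (hom-KnBar (G q) n k) (chromatic n (N q) (blowUp (G q) k))
  isTwoLevel : IsTwoLevelPolynomial g (λ _ → ∞) f
  isTwoLevel = record
    { numerical        = natural-values⇒numerical g N (proj₂ degree)
    ; eventuallyNonneg = 0 , λ q _ → nonneg q
    ; φ                = λ r → proj₁ (C-IsPoly r)
    ; onS              = λ q _ → N q , proj₂ degree q
                       -- The leading coefficient is `C 0`, which is 1.
                       , ((λ e → fromℕ-suc≢0 0 (trans (sym (coeff-fromTop (c q) (N q) 0 ℕ.z≤n)) e))
                         , coeff-fromTop-above (c q) (N q))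
                       , λ r _ → trans (codegCoeff-fromTop (c q) (N q) (λ r → C-vanish r (N q) _) r)
                                       (proj₂ (C-IsPoly r) q)
    ; offS             = λ q ¬nonneg → ⊥-elim (¬nonneg (nonneg q))
    }
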